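{- Let $(K,\prec)$ be an abstract elementary class with amalgamation, joint embedding and no maximal models, and let $\kappa>\mathrm{LS}(K)$ be a regular cardinal. Assume that the coheir relation $\downarrow^{\mathrm{ch}}$ (with respect to $\kappa$) has $(S)$. Then for every cardinal $\alpha$, $\bar\kappa_\alpha(\downarrow^{\mathrm{ch}})\le\left((\alpha+2)^{<\kappa}\right)^+$. In particular, $\downarrow^{\mathrm{ch}}$ has $(L)$. (Here all properties of $\downarrow^{\mathrm{ch}}$ are understood for base models of size at least $\kappa$.)
   Context: Setting. $(K,\prec)$ is an AEC with amalgamation, joint embedding and no maximal models; "model" means member of $K$; $\|M\|$ is the cardinality of $M$; $K_{\ge\kappa}$ is the class of models of size $\ge\kappa$. We work in a monster model $\mathfrak{C}$: the union of a strictly increasing continuous chain $(\mathfrak{C}_i)_i$ of models with $\mathfrak{C}_{i+1}$ universal over $\mathfrak{C}_i$, of length $\mathrm{OR}$ (or a cardinal much bigger than the sizes of all objects considered). Every set is a subset of $\mathfrak{C}$ and every model is a $\prec$-submodel of $\mathfrak{C}$. For sets $A,B,C$, $A\equiv_C B$ means there is an automorphism $f$ of $\mathfrak{C}$ fixing $C$ pointwise with $f[A]=B$. Coheir. Fix a regular $\kappa>\mathrm{LS}(K)$; a set or model is small if it has size $<\kappa$. For a set $A$ and models $M\prec N$, $A\downarrow^{\mathrm{ch}}_M N$ means: for every small $A^-\subseteq A$ and every small model $N^-\prec N$, there is $B^-\subseteq M$ with $B^-\equiv_{N^- }A^-$. Properties of a relation $\downarrow$ on triples $(A,M,N)$ ($A$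 a set, $M\prec N$ models; written $A\downarrow_M N$), all understood for base models in $K_{\ge\kappa}$ when applied to $\downarrow^{\mathrm{ch}}$: $(S)$ symmetry: if $A\downarrow_M N$, then there is a model $M'\succ M$ with $A\subseteq M'$ and $N\downarrow_M M'$; if $A$ is a model extending $M$ one can take $M'=A$. $(L)$ local character: $\kappa_\alpha(\downarrow)<\infty$ for every cardinal $\alpha$, where $\kappa_\alpha(\downarrow)$ is the least $\lambda$ which is a regular cardinal or $\infty$ such that for every regular $\mu\ge\lambda$, every increasing continuous chain of models $\langle M_i:i\le\mu\rangle$ and every set $A$ of size $\alpha$, there is $i_0<\mu$ with $A\downarrow_{M_{i_0}}M_\mu$. (For coheir, the models are in $K_{\ge\kappa}$.) $\bar\kappa_\alpha(\downarrow)$ is the smallest cardinal such that for all models $N$ and all sets $A$ with $|A|=\alpha$ there is a model $M\prec N$ with $\|M\|<\bar\kappa_\alpha(\downarrow)$ and $A\downarrow_M N$ ($\infty$ if there is no such cardinal). (For coheir, $M,N$ are in $K_{\ge\kappa}$.) $\theta^{<\kappa}=\sup_{\chi<\kappa}\theta^{\chi}$, and $\theta^+$ is the successor cardinal. -}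

-- Conventions.  Types in Set play the role of sets and types in Set₁ that of
-- classes; a class is a set when it is in bijection with a type in Set.  A
-- cardinal is given by any type in Set of that cardinality, and cardinals are
-- compared by injections.  Where an initial ordinal is needed (regular
-- cardinals, lengths of chains) a cardinal is given by a well-order.

module Defs where

open import Level using (Level; _⊔_; 0ℓ) renaming (suc to lsuc)
open import Data.Nat using (ℕ)
open import Data.Vec using (Vec; []; _∷_; map)
open import Data.Vec.Relation.Unary.All using (All; []; _∷_)
open import Data.Product using (Σ-syntax; ∃-syntax; _×_)
open import Data.Sum using (_⊎_)
open import Data.Unit.Polymorphic using (⊤; tt)
open import Data.Refinement using (Refinement; value) renaming (_,_ to _,ᵣ_)
open import Data.Irrelevant using (Irrelevant; [_]) renaming (map to mapᵢ; zipWith to zipWithᵢ)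
open import Function.Bundles using (_↣_; _↔_; _⇔_; module Inverse)
open import Induction.WellFounded using (WellFounded)
open import Relation.Binary.Core using (Rel)
open import Relation.Binary.Structures using (IsStrictTotalOrder)
open import Relation.Binary.PropositionalEquality using (_≡_)
open import Relation.Nullary using (¬_)
open import Relation.Unary using (Pred; _∈_; _∉_; _⊆_; _≐_)

infix 4 _≲_ _<ᶜ_

_≲_ : ∀ {a b} → Set a → Set b → Set (a ⊔ b)
X ≲ Y = X ↣ Y

_<ᶜ_ : ∀ {a b} → Set a → Set b → Set (a ⊔ b)
X <ᶜ Y = X ≲ Y × ¬ (Y ≲ X)

IsSet : Set₁ → Set₁
IsSet X = Σ[ S ∈ Set ] S ↔ X

IsLeastCardinal : ∀ {p} → Pred Set p → Pred Set (lsuc 0ℓ ⊔ p)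
IsLeastCardinal P μ = P μ × (∀ ν → P ν → μ ≲ ν)

IsSuccessor : Set → Set → Set₁
IsSuccessor θ = IsLeastCardinal (λ μ → θ <ᶜ μ)

-- IsWeakPower β κ θ says that θ = β^{<κ} = sup_{χ<κ} β^χ.
IsWeakPower : Set → Set → Set → Set₁
IsWeakPower β κ = IsLeastCardinal (λ μ → ∀ (χ : Set) → χ <ᶜ κ → (χ → β) ≲ μ)

record WellOrder (c : Level) : Set (lsuc c) where
  infix 4 _<_
  field
    ∣_∣ₒ               : Set c
    _<_                : Rel ∣_∣ₒ c
    isStrictTotalOrder : IsStrictTotalOrder _≡_ _<_
    wellFounded        : WellFounded _<_

  Segment : ∣_∣ₒ → Set c
  Segment i = Refinement ∣_∣ₒ (λ j → j < i)

  IsSuccessorOf : ∣_∣ₒ → ∣_∣ₒ → Set c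
  IsSuccessorOf i j = i < j × (∀ k → i < k → ¬ (k < j))

  IsLimit : ∣_∣ₒ → Set c
  IsLimit j = (∃[ i ] i < j) × (∀ i → i < j → ∃[ k ] (i < k × k < j))

  HasLimitLength : Set c
  HasLimitLength = ∣_∣ₒ × (∀ i → ∃[ k ] i < k)

open WellOrder public using (∣_∣ₒ)

record IsRegular (κ : WellOrder 0ℓ) : Set where
  open WellOrder κ using (_<_; Segment)
  field
    infinite : ℕ ≲ ∣ κ ∣ₒ
    initial  : ∀ i → Segment i <ᶜ ∣ κ ∣ₒ
    regular  : ∀ i (f : Segment i → ∣ κ ∣ₒ) → ∃[ b ] (∀ x → f x < b)

-- These properties determine the class OR of all ordinals up to isomorphism.
IsOR : WellOrder (lsuc 0ℓ) → Set₁
IsOR I = (∀ i → IsSet (WellOrder.Segment I i)) × ¬ IsSet ∣ I ∣ₒ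

record Signature : Set₁ where
  field
    Fun Rln : Set
    arityF  : Fun → ℕ
    arityR  : Rln → ℕ

-- The universe may be a proper class, so that the monster is a structure;
-- members of an abstract elementary class are required to be sets.
record Structure (L : Signature) : Set₂ where
  open Signature L
  field
    ∣_∣ : Set₁
    fun : (f : Fun) → Vec ∣_∣ (arityF f) → ∣_∣
    rln : (r : Rln) → Pred (Vec ∣_∣ (arityR r)) 0ℓ

open Structure public using (∣_∣)

Subset : Set₁ → Set₂
Subset X = Pred X (lsuc 0ℓ)

-- The proof of membership is irrelevant, so ⟦ P ⟧ has one element for each
-- element of the subset P.
⟦_⟧ : {X : Set₁} → Subset X → Set₁
⟦ P ⟧ = Refinement _ P

module _ {L : Signature} where
  open Signature L

  infix 4 _≅_
  record _≅_ (M N : Structure L) : Set₁ where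
    private
      module M = Structure M
      module N = Structure N
    field
      bijection : ∣ M ∣ ↔ ∣ N ∣
    open Inverse bijection public using (to; from)
    field
      preserves-fun : ∀ f xs → to (M.fun f xs) ≡ N.fun f (map to xs)
      preserves-rln : ∀ r xs → M.rln r xs ⇔ N.rln r (map to xs)

  record Substructure (A : Structure L) : Set₂ where
    open Structure A using (fun)
    field
      carrier : Subset ∣ A ∣
      closed  : ∀ f xs → All carrier xs → carrier (fun f xs)

  open Substructure public using (carrier)

  all-proofs : {X : Set₁} {P : Subset X} {n : ℕ} (xs : Vec ⟦ P ⟧ n) →
               Irrelevant (All P (map value xs))
  all-proofs []              = [ [] ]
  all-proofs ((_ ,ᵣ p) ∷ xs) = zipWithᵢ _∷_ p (all-proofs xs)

  infix 7 _↾_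
  _↾_ : (A : Structure L) → Substructure A → Structure L
  A ↾ P = record
    { ∣_∣ = ⟦ carrier P ⟧
    ; fun = λ f xs → A.fun f (map value xs) ,ᵣ
                     mapᵢ (Substructure.closed P f (map value xs)) (all-proofs xs)
    ; rln = λ r xs → A.rln r (map value xs)
    }
    where module A = Structure A

  full : (A : Structure L) → Substructure A
  full A = record { carrier = λ _ → ⊤ ; closed = λ _ _ _ → tt }

⋃ : ∀ {c} {X : Set₁} {I : Set c} → (I → Subset X) → Pred X (lsuc 0ℓ ⊔ c)
⋃ P x = ∃[ i ] x ∈ P i

record IsChain {L : Signature} {A : Structure L}
               (_≺_ : Rel (Substructure A) (lsuc 0ℓ))
               {c : Level} (I : WellOrder c)
               (M : ∣ I ∣ₒ → Substructure A) : Set (lsuc 0ℓ ⊔ c) where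
  open WellOrder I using (_<_; Segment; IsLimit)
  field
    increasing : ∀ {i j} → i < j → M i ≺ M j
    continuous : ∀ {j} → IsLimit j →
                 carrier (M j) ≐ ⋃ {I = Segment j} (λ i → carrier (M (value i)))

-- M ≺ N presupposes that M is a substructure of N; here the relation is given
-- on pairs of substructures P, Q of a common ambient structure A (which need
-- not be in K), A ∣ P ≺ Q meaning A ↾ P ≺ A ↾ Q.  By ≺-iso it depends only
-- on A ↾ Q and on the subset of it determined by P.
record AEC (L : Signature) : Set₂ where
  open Signature L
  infix 4 _∣_≺_
  field
    K     : Structure L → Set₁
    _∣_≺_ : (A : Structure L) → Rel (Substructure A) (lsuc 0ℓ)

    K-set : ∀ {M} → K M → IsSet ∣ M ∣
    K-iso : ∀ {M N} → M ≅ N → K M → K N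
    ≺-iso : ∀ {A B} {P Q : Substructure A} {P′ Q′ : Substructure B}
            (φ : A ↾ Q ≅ B ↾ Q′) →
            carrier P ⊆ carrier Q → carrier P′ ⊆ carrier Q′ →
            (∀ x → value x ∈ carrier P ⇔ value (_≅_.to φ x) ∈ carrier P′) →
            A ∣ P ≺ Q → B ∣ P′ ≺ Q′

    ≺⇒⊆     : ∀ {A P Q} → A ∣ P ≺ Q → carrier P ⊆ carrier Q
    ≺⇒K     : ∀ {A P Q} → A ∣ P ≺ Q → K (A ↾ P) × K (A ↾ Q)
    ≺-refl  : ∀ {A P} → K (A ↾ P) → A ∣ P ≺ P
    ≺-trans : ∀ {A P Q R} → A ∣ P ≺ Q → A ∣ Q ≺ R → A ∣ P ≺ R

    coherence : ∀ {A P Q R} → carrier P ⊆ carrier Q →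
                A ∣ P ≺ R → A ∣ Q ≺ R → A ∣ P ≺ Q

    chain-union : ∀ {A} (I : WellOrder 0ℓ) → WellOrder.HasLimitLength I →
                  (M : ∣ I ∣ₒ → Substructure A) → (∀ i → K (A ↾ M i)) →
                  IsChain (A ∣_≺_) I M →
                  (U : Substructure A) → carrier U ≐ ⋃ (λ i → carrier (M i)) →
                  K (A ↾ U) × (∀ i → A ∣ M i ≺ U) ×
                  (∀ N → (∀ i → A ∣ M i ≺ N) → A ∣ U ≺ N)

  IsLöwenheimSkolem : Set → Set₂
  IsLöwenheimSkolem μ =
    ℕ ≲ μ × (Fun ⊎ Rln) ≲ μ ×
    (∀ A (N : Substructure A) → K (A ↾ N) →
     (X : Subset ∣ A ∣) → X ⊆ carrier N →
     Σ[ M ∈ Substructure A ]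
       (A ∣ M ≺ N) × (X ⊆ carrier M) × (⟦ carrier M ⟧ ≲ (⟦ X ⟧ ⊎ μ)))

  field
    LS    : Set
    LS-is : IsLeastCardinal IsLöwenheimSkolem LS

module _ {L : Signature} (𝐊 : AEC L) where
  open AEC 𝐊

  record KEmbedding (M N : Structure L) : Set₂ where
    field
      image  : Substructure N
      strong : N ∣ image ≺ full N
      iso    : M ≅ N ↾ image

    apply : ∣ M ∣ → ∣ N ∣
    apply x = value (_≅_.to iso x)

  open KEmbedding

  Amalgamation : Set₂
  Amalgamation =
    ∀ {M₀ M₁ M₂} → K M₀ → K M₁ → K M₂ →
    (f₁ : KEmbedding M₀ M₁) (f₂ : KEmbedding M₀ M₂) →
    Σ[ N ∈ Structure L ] K N ×
    (Σ[ g₁ ∈ KEmbedding M₁ N ] Σ[ g₂ ∈ KEmbedding M₂ N ]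
       (∀ x → apply g₁ (apply f₁ x) ≡ apply g₂ (apply f₂ x)))

  JointEmbedding : Set₂
  JointEmbedding =
    ∀ {M₁ M₂} → K M₁ → K M₂ →
    Σ[ N ∈ Structure L ] K N × KEmbedding M₁ N × KEmbedding M₂ N

  NoMaximalModels : Set₂
  NoMaximalModels =
    ∀ {M} → K M →
    Σ[ N ∈ Structure L ] K N ×
    (Σ[ f ∈ KEmbedding M N ] ∃[ y ] y ∉ carrier (image f))

  -- Argument order: IsUniversalOver A N M says that N is universal over M, i.e.
  -- every extension of M of the same cardinality as M embeds into N over M.
  IsUniversalOver : (A : Structure L) → Rel (Substructure A) (lsuc (lsuc 0ℓ))
  IsUniversalOver A N M =
    (A ∣ M ≺ N) ×
    (∀ M′ → K M′ → (e : KEmbedding (A ↾ M) M′) → ∣ M′ ∣ ↔ ∣ A ↾ M ∣ →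
     Σ[ g ∈ KEmbedding M′ (A ↾ N) ] (∀ x → value (apply g (apply e x)) ≡ value x))

  record Monster : Set₂ where
    field
      structure : Structure L
      index     : WellOrder (lsuc 0ℓ)
      index-OR  : IsOR index
      chain     : ∣ index ∣ₒ → Substructure structure

    open WellOrder index using (_<_; IsSuccessorOf)

    field
      chain-K         : ∀ i → K (structure ↾ chain i)
      chain-isChain   : IsChain (structure ∣_≺_) index chain
      chain-strict    : ∀ {i j} → i < j →
                        ∃[ x ] (x ∈ carrier (chain j) × x ∉ carrier (chain i))
      chain-universal : ∀ {i j} → IsSuccessorOf i j →
                        IsUniversalOver structure (chain j) (chain i)
      chain-exhausts  : ∀ x → x ∈ ⋃ (λ i → carrier (chain i))

module InMonster {L : Signature} {𝐊 : AEC L} (ℭ : Monster 𝐊) where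
  open AEC 𝐊
  open Monster ℭ using (structure; index; chain)

  Sub : Set₂
  Sub = Substructure structure

  infix 4 _≺_
  _≺_ : Rel Sub (lsuc 0ℓ)
  M ≺ N = structure ∣ M ≺ N

  -- ℭ is a proper class, so M ≺ ℭ means that M ≺ ℭᵢ for some i.
  IsModel : Pred Sub (lsuc 0ℓ)
  IsModel M = ∃[ i ] M ≺ chain i

  ‖_‖ : Sub → Set₁
  ‖ M ‖ = ⟦ carrier M ⟧

  infix 4 _≡[_]_
  _≡[_]_ : Subset ∣ structure ∣ → Subset ∣ structure ∣ → Subset ∣ structure ∣ → Set₁
  A ≡[ C ] B =
    Σ[ f ∈ structure ≅ structure ]
      (∀ x → x ∈ C → _≅_.to f x ≡ x) ×
      ((λ y → ∃[ x ] (x ∈ A × _≅_.to f x ≡ y)) ≐ B)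

  Ternary : Set₃
  Ternary = Subset ∣ structure ∣ → Sub → Sub → Set₂

  Coheir : WellOrder 0ℓ → Ternary
  Coheir κ A M N =
    ∀ (A⁻ : Subset ∣ structure ∣) → A⁻ ⊆ A → ⟦ A⁻ ⟧ <ᶜ ∣ κ ∣ₒ →
    ∀ (N⁻ : Sub) → N⁻ ≺ N → ‖ N⁻ ‖ <ᶜ ∣ κ ∣ₒ →
    Σ[ B⁻ ∈ Subset ∣ structure ∣ ] (B⁻ ⊆ carrier M) × (B⁻ ≡[ carrier N⁻ ] A⁻)

  IsModel≥ : WellOrder 0ℓ → Pred Sub (lsuc 0ℓ)
  IsModel≥ κ M = IsModel M × ∣ κ ∣ₒ ≲ ‖ M ‖

  -- Properties of ↓ where all models range over the class Model.
  module Properties (Model : Pred Sub (lsuc 0ℓ)) (_↓[_]_ : Ternary) where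

    Symmetry : Set₂
    Symmetry =
      ∀ {M N} → Model M → Model N → M ≺ N →
      (∀ (A : Subset ∣ structure ∣) → IsSet ⟦ A ⟧ → A ↓[ M ] N →
        Σ[ M′ ∈ Sub ]
          Model M′ × (M ≺ M′) × (A ⊆ carrier M′) × (carrier N ↓[ M ] M′)) ×
      (∀ A → Model A → M ≺ A → carrier A ↓[ M ] N → carrier N ↓[ M ] A)

    -- The requirement on ν in the definition of κ_α(↓).  The chain
    -- ⟨Mᵢ : i ≤ μ⟩ is given as ⟨Mᵢ : i < μ⟩ together with its last model.
    LocalCharacterAt : Set → WellOrder 0ℓ → Set₂
    LocalCharacterAt α ν =
      ∀ (μ : WellOrder 0ℓ) → IsRegular μ → ∣ ν ∣ₒ ≲ ∣ μ ∣ₒ →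
      ∀ (M : ∣ μ ∣ₒ → Sub) (Mμ : Sub) → (∀ i → Model (M i)) → Model Mμ →
      IsChain _≺_ μ M → (∀ i → M i ≺ Mμ) → carrier Mμ ≐ ⋃ (λ i → carrier (M i)) →
      ∀ (A : Subset ∣ structure ∣) → ⟦ A ⟧ ↔ α →
      Σ[ i₀ ∈ ∣ μ ∣ₒ ] A ↓[ M i₀ ] Mμ

    -- κ_α(↓) = ν for a regular cardinal ν.
    Isκ : Set → WellOrder 0ℓ → Set₂
    Isκ α ν = IsRegular ν × LocalCharacterAt α ν ×
              (∀ ν′ → IsRegular ν′ → LocalCharacterAt α ν′ → ∣ ν ∣ₒ ≲ ∣ ν′ ∣ₒ)

    LocalCharacter : Set₂
    LocalCharacter = ∀ (α : Set) → Σ[ ν ∈ WellOrder 0ℓ ] Isκ α ν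

    -- κ̄_α(↓) = ν for a cardinal ν.
    Isκ̄ : Set → Set → Set₂
    Isκ̄ α = IsLeastCardinal λ ν →
      ∀ N → Model N → ∀ (A : Subset ∣ structure ∣) → ⟦ A ⟧ ↔ α →
      Σ[ M ∈ Sub ] Model M × (M ≺ N) × (‖ M ‖ <ᶜ ν) × (A ↓[ M ] N)

  module CoheirProperties (κ : WellOrder 0ℓ) = Properties (IsModel≥ κ) (Coheir κ)

-- Let N and A be given, let θ = (α + 2)^{<κ}, and let V ≻ N be a member of the chain
-- containing A.  Build M ≺ N and M₁ ≺ V of size at most θ with M ≺ M₁ and A ⊆ M₁ such that
-- every small subset of N has, over every small model inside M₁, a conjugate inside M.  Then
-- N ↓ch_M M₁ holds by construction, hence M₁ ↓ch_M N by symmetry and A ↓ch_M N by monotonicity.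
--
-- M and M₁ are unions of chains of length κ.  By regularity of κ a small model inside M₁ lies
-- inside some stage, and at each stage there are at most θ^{<κ} = θ types of small sets over
-- small submodels to realize: the monster is model-homogeneous (back and forth, from
-- amalgamation and universality of the chain), so such a type is determined by the atomic
-- diagram of an enumerated small model.
--
-- For local character, a regular ν > θ works: the base M of size at most θ is contained in
-- some member of the chain.
--
-- Every set embeds into a proper segment of the index OR of the monster, which provides the
-- well-orderings for cardinal arithmetic; excluded middle for all types provides choice.

module Submission where

open import Level using (Level; _⊔_; 0ℓ; Lift; lift; lower) renaming (suc to lsuc)
open import Axiom.ExcludedMiddle using (ExcludedMiddle)
open import Axiom.Extensionality.Propositional using (Extensionality)
open import Data.Bool.Base using (Bool; true; false)
open import Data.Empty using (⊥; ⊥-elim)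
open import Data.Fin.Base as Fin using (Fin)
import Data.Fin.Properties as Fin
open import Data.Irrelevant using ([_])
open import Data.List.Base using (List; []; _∷_)
open import Data.List.Properties using (∷-injectiveˡ; ∷-injectiveʳ; map-injective)
open import Data.Maybe.Base using (Maybe; just; nothing)
open import Data.Nat.Base using (ℕ; zero; suc)
import Data.Nat.Base as ℕ
import Data.Nat.Induction as ℕ
import Data.Nat.Properties as ℕ
open import Data.Product using (Σ; Σ-syntax; ∃-syntax; _×_; _,_; proj₁; proj₂; map₂)
open import Data.Product.Relation.Binary.Lex.Strict using (×-Lex; ×-compare; ×-transitive; ×-wellFounded)
open import Data.Refinement using (Refinement; value) renaming (_,_ to _,ᵣ_)
open import Data.Sum.Base using (_⊎_; inj₁; inj₂)
open import Data.Sum.Properties using (inj₁-injective; inj₂-injective)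
open import Data.Unit.Base using (⊤; tt)
import Data.Unit.Polymorphic as Poly
open import Data.Vec.Base as Vec using (Vec; []; _∷_)
open import Data.Vec.Relation.Unary.All as All using (All; []; _∷_)
open import Data.Vec.Relation.Binary.Pointwise.Inductive as Pointwise using (Pointwise; []; _∷_)
open import Function.Base using (_∘_; id; case_of_)
open import Function.Bundles using (_↔_; _⇔_; mk↣; mk↔ₛ′; mk⇔; module Injection; module Inverse)
open import Function.Properties.Equivalence using () renaming (sym to ⇔-sym; trans to ⇔-trans)
import Induction.WellFounded as WF
open import Relation.Binary.Definitions using (tri<; tri≈; tri>; Trichotomous)
open import Relation.Binary.PropositionalEquality as ≡ using (_≡_; _≢_; refl; sym; trans; cong; cong₂; subst)
open import Relation.Binary.Structures using (IsStrictTotalOrder)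
import Relation.Binary.Construct.On as On
open import Relation.Nullary using (¬_; Dec; yes; no; does)
open import Relation.Nullary.Decidable using (decidable-stable; recompute; True; toWitness; fromWitness)
open import Relation.Unary using (_∈_; _∉_; _⊆_; _≐_)
open import Defs

-- A direct construction of a base for A would have to handle every small submodel of N, and N may
-- be arbitrarily large. Symmetry turns the problem around: N plays the part of the set and the
-- parameters come from M₁, which has size at most θ. However large N is, its small subsets realize
-- at most θ types over small submodels of M₁, and M has to contain one realization of each.
--
-- No separate term for LS enters the bound. There are fewer than κ symbols, so an enumerated small
-- model satisfies fewer than κ atomic formulas, and LS < κ ≤ θ. The 2 in α + 2 yields κ ≤ θ by
-- Cantor's theorem and the two default values in the proof that θ^{<κ} = θ.
--
-- Two choices shape the formal part. Partial isomorphisms are represented by their graphs, so that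
-- limits of back and forth are plain unions of relations. Hulls taken at limit stages need not be
-- the unions of the earlier hulls, so unions of chains that are merely increasing have to be
-- treated as well.

module WellOrderTheory (em : ∀ {ℓ} → ExcludedMiddle ℓ) (fe : ∀ {a b} → Extensionality a b) where

  private
    variable
      a b c ℓ : Level
      X : Set a
      Y : Set b
      Z : Set c

  by-contradiction : ¬ ¬ X → X
  by-contradiction = decidable-stable em

  ¬∀⇒∃¬ : {P : X → Set ℓ} → ¬ (∀ x → P x) → ∃[ x ] ¬ P x
  ¬∀⇒∃¬ ¬∀ = by-contradiction λ ¬∃ → ¬∀ λ x → by-contradiction λ ¬p → ¬∃ (x , ¬p)

  -- By excluded middle every type is logically equivalent to one in any given universe.
  Resize : (ℓ : Level) → Set a → Set ℓ
  Resize ℓ P = Lift ℓ (True (em {P = P}))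

  resize : X → Resize ℓ X
  resize x = lift (fromWitness x)

  unresize : Resize ℓ X → X
  unresize = toWitness ∘ lower

  -- The proof stored in a refinement is irrelevant; deciding the predicate by excluded middle
  -- recovers one that can be used.
  member : {P : X → Set ℓ} (s : Refinement X P) → P (value s)
  member (_ ,ᵣ [ p ]) = recompute em p

  ref : {P : X → Set ℓ} (x : X) → P x → Refinement X P
  ref x p = x ,ᵣ [ p ]

  ref-≡ : {P : X → Set ℓ} {s t : Refinement X P} → value s ≡ value t → s ≡ t
  ref-≡ refl = refl

  -- Injections between types, Cantor and Cantor-Bernstein

  infixr 5 _⨾_
  _⨾_ : X ≲ Y → Y ≲ Z → X ≲ Z
  f ⨾ g = mk↣ (F.injective ∘ G.injective)
    where module F = Injection f
          module G = Injection g

  ≲-refl : X ≲ X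
  ≲-refl = mk↣ id

  ↔⇒≲ : X ↔ Y → X ≲ Y
  ↔⇒≲ f = mk↣ λ {x} {y} eq → trans (sym (F.strictlyInverseʳ x)) (trans (cong F.from eq) (F.strictlyInverseʳ y))
    where module F = Inverse f

  ↔⇒≳ : X ↔ Y → Y ≲ X
  ↔⇒≳ f = mk↣ λ {x} {y} eq → trans (sym (F.strictlyInverseˡ x)) (trans (cong F.to eq) (F.strictlyInverseˡ y))
    where module F = Inverse f

  ref-≲ : {P : X → Set ℓ} → Refinement X P ≲ X
  ref-≲ = mk↣ ref-≡

  -- The existential is a sum type, so totality is already a choice function; what remains is that a
  -- value determines its argument.
  choose-≲ : (R : X → Y → Set ℓ) → (∀ x → ∃[ y ] R x y) →
             (∀ {x x′ y} → R x y → R x′ y → x ≡ x′) → X ≲ Y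
  choose-≲ R total inj = mk↣ {to = λ x → proj₁ (total x)} λ {x} {x′} eq →
    inj (proj₂ (total x)) (subst (R x′) (sym eq) (proj₂ (total x′)))

  ⊆-≲ : {P : X → Set ℓ} {Q : X → Set a} → (∀ {x} → P x → Q x) → Refinement X P ≲ Refinement X Q
  ⊆-≲ P⊆Q = mk↣ {to = λ s → ref (value s) (P⊆Q (member s))} λ eq → ref-≡ (cong value eq)

  ≲-<ᶜ-trans : X ≲ Y → Y <ᶜ Z → X <ᶜ Z
  ≲-<ᶜ-trans f (g , ¬h) = f ⨾ g , λ h → ¬h (h ⨾ f)

  <ᶜ-≲-trans : X <ᶜ Y → Y ≲ Z → X <ᶜ Z
  <ᶜ-≲-trans (f , ¬h) g = f ⨾ g , λ h → ¬h (g ⨾ h)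

  -- Diagonal argument against an injection of functions: `d` takes the value `y₁` at the code of a
  -- function that is `y₀` at its own code, and `y₀` everywhere else.
  cantor : {Y : Set b} {y₀ y₁ : Y} → y₀ ≢ y₁ → ¬ ((X → Y) ≲ X)
  cantor {X = X} {Y = Y} {y₀} {y₁} y₀≢y₁ f = absurd em
    where
    open Injection f using (to; injective)
    D : X → Set _
    D x = Σ[ g ∈ (X → Y) ] (to g ≡ x × g x ≡ y₀)
    bit : ∀ {x} → Dec (D x) → Y
    bit (yes _) = y₁
    bit (no _)  = y₀
    d : X → Y
    d x = bit (em {P = D x})
    bit-yes : ∀ {x} (p : Dec (D x)) → D x → bit p ≡ y₁
    bit-yes (yes _) _ = refl
    bit-yes (no ¬p) p = ⊥-elim (¬p p)
    bit-no : ∀ {x} (p : Dec (D x)) → ¬ D x → bit p ≡ y₀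
    bit-no (yes p) ¬p = ⊥-elim (¬p p)
    bit-no (no _) _ = refl
    absurd : Dec (D (to d)) → ⊥
    absurd (yes (g , eq , gx≡y₀)) = y₀≢y₁ (trans (sym gx≡y₀)
      (trans (cong (λ h → h (to d)) (injective eq)) (bit-yes em (g , eq , gx≡y₀))))
    absurd (no ¬p) = ¬p (d , refl , bit-no em ¬p)

  -- h agrees with f on the points reached from outside the image of g by
  -- alternating g ∘ f, and with the inverse of g elsewhere.
  cantor-bernstein : {X : Set a} {Y : Set b} → X ≲ Y → Y ≲ X → X ↔ Y
  cantor-bernstein {a = a} {b = b} {X = X} {Y = Y} f g = mk↔ₛ′ h k h∘k k∘h
    where
    module F = Injection f
    module G = Injection g
    C : ℕ → X → Set (a ⊔ b)
    C zero x = Lift (a ⊔ b) (¬ (∃[ y ] G.to y ≡ x))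
    C (suc n) x = ∃[ x′ ] (C n x′ × G.to (F.to x′) ≡ x)
    C∞ : X → Set _
    C∞ x = ∃[ n ] C n x
    R : X → Y → Set _
    R x y = (C∞ x × F.to x ≡ y) ⊎ ((¬ C∞ x) × G.to y ≡ x)
    total : ∀ x → ∃[ y ] R x y
    total x with em {P = C∞ x}
    ... | yes p = F.to x , inj₁ (p , refl)
    ... | no ¬p with em {P = ∃[ y ] G.to y ≡ x}
    ...   | yes (y , eq) = y , inj₂ (¬p , eq)
    ...   | no ¬q = ⊥-elim (¬p (0 , lift ¬q))
    surj : ∀ y → ∃[ x ] R x y
    surj y with em {P = C∞ (G.to y)}
    ... | no ¬p = G.to y , inj₂ (¬p , refl)
    ... | yes (zero , lift ¬q) = ⊥-elim (¬q (y , refl))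
    ... | yes (suc n , x , p , eq) = x , inj₁ ((n , p) , G.injective eq)
    fun : ∀ {x y y′} → R x y → R x y′ → y ≡ y′
    fun (inj₁ (_ , eq)) (inj₁ (_ , eq′)) = trans (sym eq) eq′
    fun (inj₁ (p , _)) (inj₂ (¬p , _)) = ⊥-elim (¬p p)
    fun (inj₂ (¬p , _)) (inj₁ (p , _)) = ⊥-elim (¬p p)
    fun (inj₂ (_ , eq)) (inj₂ (_ , eq′)) = G.injective (trans eq (sym eq′))
    clash : ∀ {x x′ y} → C∞ x × F.to x ≡ y → (¬ C∞ x′) × G.to y ≡ x′ → ⊥
    clash ((n , p) , refl) (¬p , refl) = ¬p (suc n , _ , p , refl)
    inj : ∀ {x x′ y} → R x y → R x′ y → x ≡ x′
    inj (inj₁ (_ , eq)) (inj₁ (_ , eq′)) = F.injective (trans eq (sym eq′))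
    inj (inj₁ p) (inj₂ q) = ⊥-elim (clash p q)
    inj (inj₂ q) (inj₁ p) = ⊥-elim (clash p q)
    inj (inj₂ (_ , eq)) (inj₂ (_ , eq′)) = trans (sym eq) eq′
    h : X → Y
    h x = proj₁ (total x)
    k : Y → X
    k y = proj₁ (surj y)
    h∘k : ∀ y → h (k y) ≡ y
    h∘k y = fun (proj₂ (total (k y))) (proj₂ (surj y))
    k∘h : ∀ x → k (h x) ≡ x
    k∘h x = inj (proj₂ (surj (h x))) (proj₂ (total x))

  Σ-≲ : {X : Set a} {P : X → Set b} {Q : X → Set c} → (∀ x → P x ≲ Q x) → Σ X P ≲ Σ X Q
  Σ-≲ {P = P} f = mk↣ {to = λ (x , p) → x , Injection.to (f x) p} (λ { {x , p} {y , q} eq → inj (cong proj₁ eq) eq })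
    where
    inj : ∀ {x y p q} → x ≡ y → (x , Injection.to (f x) p) ≡ (y , Injection.to (f y) q) → (x , p) ≡ (y , q)
    inj {p = p} {q} refl eq = cong (_ ,_) (Injection.injective (f _) (snd eq))
      where
      snd : ∀ {x y z} → _≡_ {A = Σ _ _} (x , y) (x , z) → y ≡ z
      snd refl = refl

  -- Well-orders: recursion, comparison, and squares of infinite segments

  module Order (I : WellOrder c) where
    open WellOrder I public using (_<_; Segment; wellFounded)
    open IsStrictTotalOrder (WellOrder.isStrictTotalOrder I) public
      using (compare) renaming (trans to <-trans; irrefl to <-irrefl′)

    <-irrefl : ∀ {i} → ¬ (i < i)
    <-irrefl = <-irrefl′ refl

    minimal : (P : ∣ I ∣ₒ → Set ℓ) → Σ ∣ I ∣ₒ P → ∃[ i ] (P i × (∀ j → P j → ¬ (j < i)))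
    minimal P (i , p) = by-contradiction λ none →
      WF.All.wfRec wellFounded _ (λ i → ¬ P i)
        (λ i ih p → none (i , p , λ j q j<i → ih j<i q)) i p

    infix 4 _≤_
    _≤_ : ∣ I ∣ₒ → ∣ I ∣ₒ → Set c
    i ≤ j = (i < j) ⊎ (i ≡ j)

    ≮⇒≥ : ∀ {i j} → ¬ (i < j) → j ≤ i
    ≮⇒≥ {i} {j} i≮j with compare i j
    ... | tri< i<j _ _ = ⊥-elim (i≮j i<j)
    ... | tri≈ _ eq _ = inj₂ (sym eq)
    ... | tri> _ _ j<i = inj₁ j<i

    <-≤-trans : ∀ {i j k} → i < j → j ≤ k → i < k
    <-≤-trans p (inj₁ q) = <-trans p q
    <-≤-trans p (inj₂ refl) = p

    ≤-trans : ∀ {i j k} → i ≤ j → j ≤ k → i ≤ k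
    ≤-trans (inj₁ p) q = inj₁ (<-≤-trans p q)
    ≤-trans (inj₂ refl) q = q

    upper : ∀ i j → ∃[ k ] (i ≤ k × j ≤ k)
    upper i j with compare i j
    ... | tri< i<j _ _ = j , inj₁ i<j , inj₂ refl
    ... | tri≈ _ refl _ = j , inj₂ refl , inj₂ refl
    ... | tri> _ _ j<i = i , inj₂ refl , inj₁ j<i

    seg-≲ : ∀ {i j} → i ≤ j → Segment i ≲ Segment j
    seg-≲ i≤j = ⊆-≲ λ k<i → <-≤-trans k<i i≤j

    -- Feeding `F` functions on `Segment i` removes the order proofs from its argument, so
    -- extensionality suffices for the unfolding equation.
    recursion : {X : Set a} (F : ∀ i → (Segment i → X) → X) →
                Σ[ f ∈ (∣ I ∣ₒ → X) ] (∀ i → f i ≡ F i (f ∘ value))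
    recursion {X = X} F = FP.wfRec (λ _ → X) G , λ i →
        WF.FixPoint.unfold-wfRec wellFounded (λ _ → X) G
          (λ i eq → cong (F i) (fe λ s → eq (member s)))
      where
      module FP = WF.All wellFounded _
      G : ∀ i → (∀ {j} → j < i → X) → X
      G i h = F i λ s → h (member s)

    -- An unbounded family covers the order by closed initial segments: the left summand codes a
    -- point below `f x`, the right one `f x` itself. Both the regularity of successor cardinals and
    -- replacement for `OR` come from this.
    unbounded-≲ : {X : Set a} (f : X → ∣ I ∣ₒ) → ¬ (∃[ b ] (∀ x → f x < b)) →
                  ∣ I ∣ₒ ≲ (Σ[ x ∈ X ] (Segment (f x) ⊎ ⊤))
    unbounded-≲ {X = X} f unbounded =
      choose-≲ R (λ i → total (¬∀⇒∃¬ λ bound → unbounded (i , bound))) λ {i} {j} {s} → R-inj {i} {j} {s}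
      where
      R : ∣ I ∣ₒ → Σ[ x ∈ X ] (Segment (f x) ⊎ ⊤) → Set _
      R i (x , inj₁ s) = i ≡ value s
      R i (x , inj₂ _) = i ≡ f x
      total : ∀ {i} → (∃[ x ] ¬ (f x < i)) → ∃[ s ] R i s
      total {i} (x , ¬lt) with ≮⇒≥ ¬lt
      ... | inj₁ lt = (x , inj₁ (ref i lt)) , refl
      ... | inj₂ eq = (x , inj₂ tt) , eq
      R-inj : ∀ {i j s} → R i s → R j s → i ≡ j
      R-inj {s = _ , inj₁ _} e e′ = trans e (sym e′)
      R-inj {s = _ , inj₂ _} e e′ = trans e (sym e′)

    -- If `Y` embeds into no segment, then no function from a segment reaches all of `Y`, and
    -- recursion can always pick a fresh value.
    compare-with : (Y : Set b) → (∣ I ∣ₒ ≲ Y) ⊎ (∃[ i ] Y ≲ Segment i)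
    compare-with Y with em {P = ∃[ i ] Y ≲ Segment i}
    ... | yes p = inj₂ p
    ... | no ¬p = inj₁ (mk↣ injective)
      where
      fresh : ∀ i (h : Segment i → Y) → ∃[ y ] (∀ s → h s ≢ y)
      fresh i h = by-contradiction λ none → ¬p (i , choose-≲ (λ y s → h s ≡ y)
        (λ y → by-contradiction λ none′ → none (y , λ s eq → none′ (s , eq)))
        λ eq eq′ → trans (sym eq) eq′)
      rec = recursion λ i h → proj₁ (fresh i h)
      g = proj₁ rec
      distinct : ∀ {i j} → j < i → g j ≢ g i
      distinct {i} j<i eq = proj₂ (fresh i (g ∘ value)) (ref _ j<i) (trans eq (proj₂ rec i))
      injective : ∀ {i j} → g i ≡ g j → i ≡ j
      injective {i} {j} eq with compare i j
      ... | tri< i<j _ _ = ⊥-elim (distinct i<j eq)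
      ... | tri≈ _ i≡j _ = i≡j
      ... | tri> _ _ j<i = ⊥-elim (distinct j<i (sym eq))

  -- The relation is resized to the level of `X`, so that a type in `Set` inherits a well-order in
  -- `Set` even from a proper class.
  pullback : {X : Set a} (I : WellOrder c) → X ≲ ∣ I ∣ₒ → WellOrder a
  pullback {a = a} {X = X} I f = record
    { ∣_∣ₒ = X
    ; _<_ = _<_
    ; isStrictTotalOrder = record
      { isStrictPartialOrder = record
        { isEquivalence = ≡.isEquivalence
        ; irrefl = λ { refl p → I.<-irrefl (unresize p) }
        ; trans = λ p q → resize (I.<-trans (unresize p) (unresize q))
        ; <-resp-≈ = (λ { refl p → p }) , λ { refl p → p }
        }
      ; compare = cmp
      }
    ; wellFounded = WF.Subrelation.wellFounded unresize (On.wellFounded F.to I.wellFounded)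
    }
    where
    module I = Order I
    module F = Injection f
    _<_ : X → X → Set a
    x < y = Resize a (F.to x I.< F.to y)
    cmp : Trichotomous _≡_ _<_
    cmp x y with I.compare (F.to x) (F.to y)
    ... | tri< p ¬q ¬r = tri< (resize p) (¬q ∘ cong F.to) (¬r ∘ unresize)
    ... | tri≈ ¬p q ¬r = tri≈ (¬p ∘ unresize) (F.injective q) (¬r ∘ unresize)
    ... | tri> ¬p ¬q r = tri> (¬p ∘ unresize) (¬q ∘ cong F.to) (resize r)

  pullback-segment : {X : Set a} (I : WellOrder c) (f : X ≲ ∣ I ∣ₒ) (x : X) →
                     WellOrder.Segment (pullback I f) x ≲ WellOrder.Segment I (Injection.to f x)
  pullback-segment I f x = mk↣ {to = λ s → ref (F.to (value s)) (unresize (member s))}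
    λ eq → ref-≡ (F.injective (cong value eq))
    where module F = Injection f

  module _ (I : WellOrder c) where
    open Order I

    below : ∣ I ∣ₒ → WellOrder c
    below i = pullback {X = Segment i} I ref-≲

    below-segment : ∀ i s → WellOrder.Segment (below i) s ≲ Segment (value s)
    below-segment i s = pullback-segment I ref-≲ s

    segment-compare : ∀ i (Y : Set b) → (Segment i ≲ Y) ⊎ (∃[ j ] (j < i × (Y ≲ Segment j)))
    segment-compare i Y with Order.compare-with (below i) Y
    ... | inj₁ f = inj₁ f
    ... | inj₂ (s , f) = inj₂ (value s , member s , f ⨾ below-segment i s)

  lex : WellOrder a → WellOrder b → WellOrder (a ⊔ b)
  lex {a} {b} I J = record
    { ∣_∣ₒ = ∣ I ∣ₒ × ∣ J ∣ₒ
    ; _<_ = λ p q → Lift (a ⊔ b) (p ≺ q)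
    ; isStrictTotalOrder = record
      { isStrictPartialOrder = record
        { isEquivalence = ≡.isEquivalence
        ; irrefl = λ { refl (lift (inj₁ p)) → I.<-irrefl p ; refl (lift (inj₂ (_ , p))) → J.<-irrefl p }
        ; trans = λ {x} {y} {z} (lift p) (lift q) → lift (lex-trans {x} {y} {z} p q)
        ; <-resp-≈ = (λ { refl p → p }) , λ { refl p → p }
        }
      ; compare = cmp
      }
    ; wellFounded = WF.Subrelation.wellFounded lower (×-wellFounded I.wellFounded J.wellFounded)
    }
    where
    module I = Order I
    module J = Order J
    _≺_ = ×-Lex _≡_ I._<_ J._<_
    lex-trans = ×-transitive {_<₂_ = J._<_} ≡.isEquivalence (≡.resp₂ I._<_) I.<-trans J.<-trans
    cmp : Trichotomous _≡_ (λ p q → Lift (a ⊔ b) (p ≺ q))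
    cmp p q with ×-compare sym I.compare J.compare p q
    ... | tri< x ¬y ¬z = tri< (lift x) (λ { refl → ¬y (refl , refl) }) (¬z ∘ lower)
    ... | tri≈ ¬x (refl , refl) ¬z = tri≈ (¬x ∘ lower) refl (¬z ∘ lower)
    ... | tri> ¬x ¬y z = tri> (¬x ∘ lower) (λ { refl → ¬y (refl , refl) }) (lift z)

  ×-≲ : {X : Set a} {Y : Set b} {X′ : Set c} {Y′ : Set ℓ} → X ≲ X′ → Y ≲ Y′ → (X × Y) ≲ (X′ × Y′)
  ×-≲ f g = mk↣ {to = λ (x , y) → F.to x , G.to y} λ eq →
    cong₂ _,_ (F.injective (cong proj₁ eq)) (G.injective (cong proj₂ eq))
    where module F = Injection f
          module G = Injection g

  ⊎-≲ : {X : Set a} {Y : Set b} {X′ : Set c} {Y′ : Set ℓ} → X ≲ X′ → Y ≲ Y′ → (X ⊎ Y) ≲ (X′ ⊎ Y′)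
  ⊎-≲ {X = X} {Y = Y} {X′ = X′} {Y′ = Y′} f g = mk↣ injective
    where
    module F = Injection f
    module G = Injection g
    h : X ⊎ Y → X′ ⊎ Y′
    h (inj₁ x) = inj₁ (F.to x)
    h (inj₂ y) = inj₂ (G.to y)
    injective : ∀ {s t} → h s ≡ h t → s ≡ t
    injective {inj₁ _} {inj₁ _} eq = cong inj₁ (F.injective (inj₁-injective eq))
    injective {inj₂ _} {inj₂ _} eq = cong inj₂ (G.injective (inj₂-injective eq))

  ⊎-≲-× : {W : Set ℓ} {X : Set a} {Y : Set b} {Z : Set c} {w₀ w₁ : W} → w₀ ≢ w₁ →
          X ≲ Z → Y ≲ Z → (X ⊎ Y) ≲ (W × Z)
  ⊎-≲-× {W = W} {X} {Y} {Z} {w₀} {w₁} w₀≢w₁ f g = mk↣ injective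
    where
    module F = Injection f
    module G = Injection g
    h : X ⊎ Y → W × Z
    h (inj₁ x) = w₀ , F.to x
    h (inj₂ y) = w₁ , G.to y
    injective : ∀ {s t} → h s ≡ h t → s ≡ t
    injective {inj₁ _} {inj₁ _} eq = cong inj₁ (F.injective (cong proj₂ eq))
    injective {inj₁ _} {inj₂ _} eq = ⊥-elim (w₀≢w₁ (cong proj₁ eq))
    injective {inj₂ _} {inj₁ _} eq = ⊥-elim (w₀≢w₁ (sym (cong proj₁ eq)))
    injective {inj₂ _} {inj₂ _} eq = cong inj₂ (G.injective (cong proj₂ eq))

  ℕ-order : WellOrder 0ℓ
  ℕ-order = record { isStrictTotalOrder = ℕ.<-isStrictTotalOrder ; wellFounded = ℕ.<-wellFounded }

  infinite⊎finite : (X : Set a) → (ℕ ≲ X) ⊎ (∃[ n ] X ≲ Fin n)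
  infinite⊎finite X with Order.compare-with ℕ-order X
  ... | inj₁ f = inj₁ f
  ... | inj₂ (n , f) = inj₂ (n , f ⨾ mk↣ {to = λ s → Fin.fromℕ< (member s)} λ {s} {t} eq →
          ref-≡ (Fin.fromℕ<-injective _ _ (member s) (member t) eq))

  ℕ≴Fin : ∀ {n} → ¬ (ℕ ≲ Fin n)
  ℕ≴Fin f = Fin.ℕ→Fin-notInjective (Injection.to f) (Injection.injective f)

  Fin-× : ∀ m n → (Fin m × Fin n) ≲ Fin (m ℕ.* n)
  Fin-× m n = mk↣ {to = λ (i , j) → Fin.combine i j} λ {(i , j)} {(k , l)} eq →
    case Fin.combine-injective i j k l eq of λ { (refl , refl) → refl }

  ℕ-distinct : {X : Set a} (f : ℕ ≲ X) → Injection.to f 0 ≢ Injection.to f 1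
  ℕ-distinct f eq = case Injection.injective f eq of λ ()

  module Gödel (W : WellOrder c) where
    open Order W

    max : ∣ W ∣ₒ × ∣ W ∣ₒ → ∣ W ∣ₒ
    max (s , t) = proj₁ (upper s t)

    -- Gödel's order on pairs compares maxima first, so the predecessors of a pair lie in the square
    -- of a closed initial segment.
    order : WellOrder c
    order = pullback (lex W (lex W W)) (mk↣ {to = λ p → max p , p} (cong proj₂))

    max-mono : ∀ {p q} → WellOrder._<_ order q p → max q ≤ max p
    max-mono lt with lower (unresize lt)
    ... | inj₁ r = inj₁ r
    ... | inj₂ (r , _) = inj₂ r

    segment-≲ : ∀ p → WellOrder.Segment order p ≲
                      ((Segment (max p) ⊎ ⊤) × (Segment (max p) ⊎ ⊤))
    segment-≲ p = choose-≲ (λ q (u , v) → R (proj₁ (value q)) u × R (proj₂ (value q)) v)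
      (λ q → let (_ , le₁ , le₂) = upper (proj₁ (value q)) (proj₂ (value q))
                 le = max-mono (member q)
                 (u , ru) = total (≤-trans le₁ le)
                 (v , rv) = total (≤-trans le₂ le)
             in (u , v) , ru , rv)
      λ {x} {x′} {y} (e₁ , e₂) (e₁′ , e₂′) →
        ref-≡ (cong₂ _,_ (R-inj {u = proj₁ y} e₁ e₁′) (R-inj {u = proj₂ y} e₂ e₂′))
      where
      R : ∣ W ∣ₒ → Segment (max p) ⊎ ⊤ → Set _
      R s (inj₁ u) = s ≡ value u
      R s (inj₂ _) = s ≡ max p
      total : ∀ {s} → s ≤ max p → ∃[ u ] R s u
      total {s} (inj₁ q) = inj₁ (ref s q) , refl
      total (inj₂ q) = inj₂ tt , q
      R-inj : ∀ {s s′ u} → R s u → R s′ u → s ≡ s′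
      R-inj {u = inj₁ _} e e′ = trans e (sym e′)
      R-inj {u = inj₂ _} e e′ = trans e (sym e′)

  ≲-⊤ : {X : Set a} → X → ⊤ ≲ X
  ≲-⊤ x = mk↣ {to = λ _ → x} λ _ → refl

  absorb-⊤ : {X : Set a} → ℕ ≲ X → (X × X) ≲ X → (X ⊎ ⊤) ≲ X
  absorb-⊤ inf sq = ⊎-≲-× (ℕ-distinct inf) ≲-refl (≲-⊤ (Injection.to inf 0)) ⨾ sq

  -- Hessenberg's theorem by induction on `i`. If `Segment i` embeds into no earlier segment and its
  -- square does not embed into it, then it embeds into a proper segment of Gödel's order, hence
  -- into the square of a closed segment ending at some `m` below `i`. That square is finite, or by
  -- induction no larger than `Segment m`; both are impossible.
  segment-square : (I : WellOrder c) → let open Order I in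
                   ∀ i → ℕ ≲ Segment i → (Segment i × Segment i) ≲ Segment i
  segment-square I = WF.All.wfRec wellFounded _ _ step
    where
    open Order I
    step : ∀ i → (∀ {j} → j < i → ℕ ≲ Segment j → (Segment j × Segment j) ≲ Segment j) →
           ℕ ≲ Segment i → (Segment i × Segment i) ≲ Segment i
    step i ih inf with em {P = ∃[ j ] (j < i × (Segment i ≲ Segment j))}
    ... | yes (j , j<i , f) = ×-≲ f f ⨾ ih j<i (inf ⨾ f) ⨾ seg-≲ (inj₁ j<i)
    ... | no initial with Order.compare-with (Gödel.order (below I i)) (Segment i)
    ...   | inj₁ f = f
    ...   | inj₂ (p , f) = ⊥-elim (absurd (infinite⊎finite (Segment m)))
      where
      module G = Gödel (below I i)
      m = value (G.max p)
      m<i = member (G.max p)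
      square : Segment i ≲ ((Segment m ⊎ ⊤) × (Segment m ⊎ ⊤))
      square = f ⨾ G.segment-≲ p ⨾ ×-≲ g g
        where g = ⊎-≲ (below-segment I i (G.max p)) ≲-refl
      absurd : (ℕ ≲ Segment m) ⊎ (∃[ n ] Segment m ≲ Fin n) → ⊥
      absurd (inj₁ inf-m) = initial (m , m<i , square ⨾ ×-≲ absorb absorb ⨾ sq)
        where
        sq = ih m<i inf-m
        absorb = absorb-⊤ inf-m sq
      absurd (inj₂ (n , g)) = ℕ≴Fin (inf ⨾ square ⨾ ×-≲ finite finite ⨾ Fin-× _ _)
        where
        finite : (Segment m ⊎ ⊤) ≲ Fin (n ℕ.+ 1)
        finite = ⊎-≲ g (≲-⊤ Fin.zero) ⨾ ↔⇒≳ Fin.+↔⊎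

-- Cardinal arithmetic with well-orders taken from the class of ordinals

module CardinalTheory (em : ∀ {ℓ} → ExcludedMiddle ℓ) (fe : ∀ {a b} → Extensionality a b) where

  open WellOrderTheory em fe

  private
    variable
      a b c ℓ : Level

  ⋃-≲ : {I : Set b} {X : Set a} {Y : Set c} (P : I → X → Set ℓ) → (∀ i → Refinement X (P i) ≲ Y) →
        Refinement X (λ x → ∃[ i ] P i x) ≲ (I × Y)
  ⋃-≲ {X = X} P f = choose-≲ {X = Refinement X (λ x → ∃[ i ] P i x)} (λ s (i , y) → Σ[ p ∈ P i (value s) ] Injection.to (f i) (ref (value s) p) ≡ y)
    (λ s → let (i , p) = member s in _ , p , refl)
    λ {s} {t} {(i , y)} (p , eq) (q , eq′) →
      ref-≡ (cong value (Injection.injective (f i) {ref (value s) p} {ref (value t) q} (trans eq (sym eq′))))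

  ∪-≲ : {X : Set a} (P : X → Set b) (Q : X → Set c) →
        Refinement X (λ x → P x ⊎ Q x) ≲ (Refinement X P ⊎ Refinement X Q)
  ∪-≲ {X = X} P Q = choose-≲ R total R-inj
    where
    R : Refinement X (λ x → P x ⊎ Q x) → Refinement X P ⊎ Refinement X Q → Set _
    R s (inj₁ t) = value s ≡ value t
    R s (inj₂ t) = value s ≡ value t
    total : ∀ s → ∃[ t ] R s t
    total s with member s
    ... | inj₁ p = inj₁ (ref (value s) p) , refl
    ... | inj₂ q = inj₂ (ref (value s) q) , refl
    R-inj : ∀ {s s′ t} → R s t → R s′ t → s ≡ s′
    R-inj {t = inj₁ _} e e′ = ref-≡ (trans e (sym e′))
    R-inj {t = inj₂ _} e e′ = ref-≡ (trans e (sym e′))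

  →-≲ : {X : Set a} {Y : Set b} {Z : Set c} → Y ≲ Z → (X → Y) ≲ (X → Z)
  →-≲ f = mk↣ {to = λ g x → F.to (g x)} λ eq → fe λ x → F.injective (cong (λ h → h x) eq)
    where module F = Injection f

  →-≲ˡ : {X : Set a} {X′ : Set b} {Y : Set c} → Y → X ≲ X′ → (X → Y) ≲ (X′ → Y)
  →-≲ˡ {X′ = X′} {Y} y₀ f = choose-≲ (λ g h → ∀ x → h (F.to x) ≡ g x) extend
      λ p q → fe λ x → trans (sym (p x)) (q x)
    where
    module F = Injection f
    extend : ∀ g → ∃[ h ] (∀ x → h (F.to x) ≡ g x)
    extend g = (λ x′ → proj₁ (val x′)) , λ x → proj₂ (val (F.to x)) x refl
      where
      val : ∀ x′ → ∃[ y ] (∀ x → F.to x ≡ x′ → y ≡ g x)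
      val x′ with em {P = ∃[ x ] F.to x ≡ x′}
      ... | yes (x , refl) = g x , λ z eq → cong g (F.injective (sym eq))
      ... | no ¬p = y₀ , λ x eq → ⊥-elim (¬p (x , eq))

  -- The length is recorded because iterated pairing alone does not show where the list ends.
  List-≲ : {X : Set a} → (X × X) ≲ X → X → List X ≲ (ℕ × X)
  List-≲ {X = X} sq x₀ = mk↣ injective
    where
    module F = Injection sq
    code : List X → ℕ × X
    code [] = 0 , x₀
    code (x ∷ xs) = suc (proj₁ (code xs)) , F.to (x , proj₂ (code xs))
    injective : ∀ {xs ys} → code xs ≡ code ys → xs ≡ ys
    injective {[]} {[]} eq = refl
    injective {x ∷ xs} {y ∷ ys} eq = cong₂ _∷_ (cong proj₁ eq₂)
        (injective (cong₂ _,_ (ℕ.suc-injective (cong proj₁ eq)) (cong proj₂ eq₂)))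
      where eq₂ = F.injective (cong proj₂ eq)

  Σ-Vec-≲ : {I : Set a} {X : Set b} (n : I → ℕ) → (Σ[ i ∈ I ] Vec X (n i)) ≲ (I × List X)
  Σ-Vec-≲ n = mk↣ {to = λ (i , xs) → i , Vec.toList xs} injective
    where
    toList-inj : ∀ {X : Set b} {n} (xs ys : Vec X n) → Vec.toList xs ≡ Vec.toList ys → xs ≡ ys
    toList-inj [] [] eq = refl
    toList-inj (x ∷ xs) (y ∷ ys) eq = cong₂ _∷_ (∷-injectiveˡ eq) (toList-inj xs ys (∷-injectiveʳ eq))
    injective : ∀ {s t} → _ ≡ _ → s ≡ t
    injective {(i , xs)} {(j , ys)} eq with cong proj₁ eq
    ... | refl = cong (i ,_) (toList-inj xs ys (cong proj₂ eq))

  -- The image of the injection, resized to `Set`, is the required set.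
  ≲⇒IsSet : {X : Set₁} {S : Set} → X ≲ S → IsSet X
  ≲⇒IsSet {X} {S} f = S′ , mk↔ₛ′ (proj₁ ∘ preimage) to (λ x → F.injective (proj₂ (preimage (to x))))
      λ s → ref-≡ (proj₂ (preimage s))
    where
    module F = Injection f
    S′ : Set
    S′ = Refinement S (λ s → Resize 0ℓ (∃[ x ] F.to x ≡ s))
    preimage : (s : S′) → ∃[ x ] F.to x ≡ value s
    preimage s = unresize (member s)
    to : X → S′
    to x = ref (F.to x) (resize (x , refl))

  module Cardinals (OR : WellOrder (lsuc 0ℓ)) (isOR : IsOR OR) where
    open Order OR

    segment-set : ∀ i → IsSet (Segment i)
    segment-set = proj₁ isOR

    -- By comparability the alternative is an injection of the proper class `OR` into a set.
    ≲-segment : (X : Set) → ∃[ i ] X ≲ Segment i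
    ≲-segment X with compare-with X
    ... | inj₁ f = ⊥-elim (proj₂ isOR (≲⇒IsSet f))
    ... | inj₂ p = p

    -- Replacement: an unbounded family indexed by a set would cover `OR` by set many segments, each
    -- of them a set.
    bounded : {X : Set} (f : X → ∣ OR ∣ₒ) → ∃[ i ] (∀ x → f x < i)
    bounded {X} f = by-contradiction λ unbounded → proj₂ isOR (≲⇒IsSet
      (unbounded-≲ f unbounded ⨾ Σ-≲ λ x → ⊎-≲ (↔⇒≳ (proj₂ (segment-set (f x)))) ≲-refl))

    above : ∀ i → ∃[ j ] i < j
    above i = let (j , lt) = bounded {⊤} (λ _ → i) in j , lt tt

    -- Among the types with property `Q`, one is taken whose embedding into a segment of `OR` uses
    -- the earliest segment; a type that does not receive it would embed into an earlier one.
    least-cardinal : (Q : Set → Set ℓ) → Σ Set Q → Σ[ X ∈ Set ] (Q X × (∀ Y → Q Y → X ≲ Y))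
    least-cardinal Q (X₀ , q₀) =
      let (i₀ , f₀) = ≲-segment X₀
          (i , (X , q , f) , least) = minimal (λ i → Σ[ X ∈ Set ] (Q X × (X ≲ Segment i))) (i₀ , X₀ , q₀ , f₀)
      in X , q , λ Y qY → case segment-compare OR i Y of λ
        { (inj₁ g) → f ⨾ g
        ; (inj₂ (j , j<i , g)) → ⊥-elim (least j (Y , qY , g) j<i) }

    -- The order is pulled back from the least segment of `OR` that receives `X`; its minimality
    -- makes all proper segments smaller than `X`.
    initial-order : (X : Set) → Σ[ W ∈ WellOrder 0ℓ ] (X ≲ ∣ W ∣ₒ × (∣ W ∣ₒ ≲ X) ×
                    (∀ x → WellOrder.Segment W x <ᶜ ∣ W ∣ₒ))
    initial-order X =
      let (i , f , least) = minimal (λ i → X ≲ Segment i) (≲-segment X)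
          f′ = f ⨾ ref-≲
      in pullback OR f′ , ≲-refl , ≲-refl , λ x → ref-≲ , λ g →
        least _ (g ⨾ pullback-segment OR f′ x) (member (Injection.to f x))

    infinite-square : (X : Set) → ℕ ≲ X → (X × X) ≲ X
    infinite-square X inf =
      let (i , f , least) = minimal (λ i → X ≲ Segment i) (≲-segment X)
          sq = ×-≲ f f ⨾ segment-square OR i (inf ⨾ f)
      in case segment-compare OR i X of λ
        { (inj₁ g) → sq ⨾ g
        ; (inj₂ (j , j<i , g)) → ⊥-elim (least j g j<i) }

    infinite-⊎ : {X : Set} {Y : Set a} {Z : Set b} → ℕ ≲ X → Y ≲ X → Z ≲ X → (Y ⊎ Z) ≲ X
    infinite-⊎ {X = X} inf f g = ⊎-≲-× (ℕ-distinct inf) f g ⨾ infinite-square X inf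

    ≲-total : (X : Set) (Y : Set b) → (X ≲ Y) ⊎ (Y ≲ X)
    ≲-total X Y =
      let (i , f) = ≲-segment X in
      case Order.compare-with (pullback OR (f ⨾ ref-≲)) Y of λ
        { (inj₁ g) → inj₁ g
        ; (inj₂ (x , g)) → inj₂ (g ⨾ ref-≲) }

    successor : (θ : Set) → Σ[ θ⁺ ∈ Set ] IsSuccessor θ θ⁺
    successor θ = least-cardinal (θ <ᶜ_) ((θ → Bool) , mk↣ injective , cantor {y₀ = false} {true} λ ())
      where
      single : θ → θ → Bool
      single x y = does (em {P = x ≡ y})
      injective : ∀ {x y} → single x ≡ single y → x ≡ y
      injective {x} {y} eq with em {P = x ≡ x} | em {P = x ≡ y} | em {P = y ≡ y} | cong (λ h → h y) eq
      ... | _ | yes p | _ | _ = p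
      ... | _ | no _ | yes _ | ()
      ... | _ | no _ | no ¬q | _ = ⊥-elim (¬q refl)

    -- The successor of an infinite cardinal is regular: its segments have size at most `θ`, so an
    -- unbounded map from one of them would cover the successor by `θ` many sets of size at most
    -- `θ`.
    regular-above : (θ : Set) → ℕ ≲ θ → Σ[ ν ∈ WellOrder 0ℓ ] (IsRegular ν × θ <ᶜ ∣ ν ∣ₒ)
    regular-above θ inf =
      let (θ⁺ , θ<θ⁺ , least) = successor θ
          (ν , f , g , initial) = initial-order θ⁺
          module ν = Order ν
          seg≲θ : ∀ i → ν.Segment i ≲ θ
          seg≲θ i = case ≲-total θ (ν.Segment i) of λ
            { (inj₂ h) → h
            ; (inj₁ h) → by-contradiction λ ¬k →
                proj₂ (initial i) (g ⨾ least (ν.Segment i) (h , ¬k)) }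
          regular : ∀ i (h : ν.Segment i → ∣ ν ∣ₒ) → ∃[ b ] (∀ x → h x ν.< b)
          regular i h = by-contradiction λ unbounded → proj₂ θ<θ⁺
            (f ⨾ ν.unbounded-≲ h unbounded ⨾
             Σ-≲ (λ x → ⊎-≲ (seg≲θ (h x)) ≲-refl) ⨾
             ×-≲ (seg≲θ i) (absorb-⊤ inf sq) ⨾ sq)
      in ν , record { infinite = inf ⨾ proj₁ θ<θ⁺ ⨾ f ; initial = initial ; regular = regular }
           , <ᶜ-≲-trans θ<θ⁺ f
      where
      sq = infinite-square θ inf

    module Regular (κ : WellOrder 0ℓ) (κ-regular : IsRegular κ) where
      open IsRegular κ-regular
      private module κ = Order κ

      small⇒segment : {X : Set a} → X <ᶜ ∣ κ ∣ₒ → ∃[ i ] X ≲ κ.Segment i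
      small⇒segment {X = X} (_ , ¬f) with κ.compare-with X
      ... | inj₁ f = ⊥-elim (¬f f)
      ... | inj₂ p = p

      κ-bounded : {X : Set a} → X <ᶜ ∣ κ ∣ₒ → (f : X → ∣ κ ∣ₒ) → ∃[ b ] (∀ x → f x κ.< b)
      κ-bounded {X = X} small f =
        let (i , e) = small⇒segment small
            module E = Injection e
            val : ∀ s → ∃[ j ] (∀ x → E.to x ≡ s → j ≡ f x)
            val s = case em {P = ∃[ x ] E.to x ≡ s} of λ
              { (yes (x , refl)) → f x , λ y eq → cong f (E.injective (sym eq))
              ; (no ¬p) → Injection.to infinite 0 , λ x eq → ⊥-elim (¬p (x , eq)) }
            (b , bound) = regular i (proj₁ ∘ val)
        in b , λ x → subst (κ._< b) (proj₂ (val (E.to x)) x refl) (bound (E.to x))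

      ⊤-small : ⊤ <ᶜ ∣ κ ∣ₒ
      ⊤-small = ≲-⊤ (Injection.to infinite 0) , λ f → ℕ-distinct (infinite ⨾ f) refl

      κ-above : ∀ i → ∃[ j ] i κ.< j
      κ-above i = let (j , lt) = κ-bounded ⊤-small (λ _ → i) in j , lt tt

      segment-small : ∀ i → κ.Segment i <ᶜ ∣ κ ∣ₒ
      segment-small = initial

      -- Suppose κ embeds into the sum. By regularity the indices sent to the left summand are
      -- bounded, and so are those sent to the right; an index above both bounds has nowhere to go.
      ⊎-small : {X : Set a} {Y : Set b} → X <ᶜ ∣ κ ∣ₒ → Y <ᶜ ∣ κ ∣ₒ → (X ⊎ Y) <ᶜ ∣ κ ∣ₒ
      ⊎-small {X = X} {Y} sX sY = infinite-⊎ infinite (proj₁ sX) (proj₁ sY) , λ f →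
        let module F = Injection f
            preimage : ∀ s → ∃[ j ] (∀ k → F.to k ≡ s → j ≡ k)
            preimage s = case em {P = ∃[ k ] F.to k ≡ s} of λ
              { (yes (k , eq)) → k , λ k′ eq′ → F.injective (trans eq (sym eq′))
              ; (no ¬p) → Injection.to infinite 0 , λ k eq → ⊥-elim (¬p (k , eq)) }
            (b , lt₁) = κ-bounded sX (proj₁ ∘ preimage ∘ inj₁)
            (c , lt₂) = κ-bounded sY (proj₁ ∘ preimage ∘ inj₂)
            (d , b≤d , c≤d) = κ.upper b c
            out : ∀ s → F.to d ≡ s → ⊥
            out = λ
              { (inj₁ x) eq → κ.<-irrefl (κ.<-≤-trans (subst (κ._< b) (proj₂ (preimage (inj₁ x)) d eq) (lt₁ x)) b≤d)
              ; (inj₂ y) eq → κ.<-irrefl (κ.<-≤-trans (subst (κ._< c) (proj₂ (preimage (inj₂ y)) d eq) (lt₂ y)) c≤d) }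
        in out (F.to d) refl

      module Powers (ℕ-small : ℕ <ᶜ ∣ κ ∣ₒ) {β : Set} (b₀ b₁ : β) (b₀≢b₁ : b₀ ≢ b₁) where

        -- The summand ℕ makes the sum infinite, hence as large as its own square.
        ×-small : {X Y : Set} → X <ᶜ ∣ κ ∣ₒ → Y <ᶜ ∣ κ ∣ₒ → (X × Y) <ᶜ ∣ κ ∣ₒ
        ×-small {X} {Y} sX sY = ≲-<ᶜ-trans
          (×-≲ (mk↣ {to = inj₁ {B = Y}} inj₁-injective ⨾ mk↣ inj₁-injective)
               (mk↣ {to = inj₂ {A = X}} inj₂-injective ⨾ mk↣ inj₁-injective)
            ⨾ infinite-square ((X ⊎ Y) ⊎ ℕ) (mk↣ inj₂-injective))
          (⊎-small (⊎-small sX sY) ℕ-small)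

        List-small : {X : Set} → X <ᶜ ∣ κ ∣ₒ → List X <ᶜ ∣ κ ∣ₒ
        List-small {X} sX = ≲-<ᶜ-trans
          (List-map ⨾ List-≲ sq (inj₂ 0) ⨾ ×-≲ inf ≲-refl ⨾ sq) (⊎-small sX ℕ-small)
          where
          inf : ℕ ≲ (X ⊎ ℕ)
          inf = mk↣ inj₂-injective
          sq = infinite-square (X ⊎ ℕ) inf
          List-map : List X ≲ List (X ⊎ ℕ)
          List-map = mk↣ (map-injective inj₁-injective)

        -- The sum of the powers of `β` with exponent below κ stands for their supremum. There are
        -- only κ summands, and `Θ-weakPower` shows that the two agree.
        Θ : Set
        Θ = Σ[ i ∈ ∣ κ ∣ₒ ] (κ.Segment i → β)

        κ≲Θ : ∣ κ ∣ₒ ≲ Θ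
        κ≲Θ = mk↣ {to = λ i → i , λ _ → b₀} (cong proj₁)

        Θ-infinite : ℕ ≲ Θ
        Θ-infinite = infinite ⨾ κ≲Θ

        Θ-square : (Θ × Θ) ≲ Θ
        Θ-square = infinite-square Θ Θ-infinite

        β-power : {X : Set a} → X <ᶜ ∣ κ ∣ₒ → (X → β) ≲ Θ
        β-power {X = X} small = let (i , f) = small⇒segment small in
          →-≲ˡ b₀ f ⨾ mk↣ {to = i ,_} λ { refl → refl }

        -- A pair (i , u) with i < b is coded by a function on Segment b × Bool, whose values
        -- at (s , false) and (s , true) both equal u s if s < i and are distinct otherwise.
        Encodes : {X : Set} → (X → Θ) → Σ[ b ∈ ∣ κ ∣ₒ ] (X × (κ.Segment b × Bool) → β) → Set
        Encodes f (b , h) = ∀ x → let (i , u) = f x in i κ.< b ×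
          (∀ s (lt : value s κ.< i) (e : Bool) → h (x , s , e) ≡ u (ref (value s) lt)) ×
          (∀ s → ¬ (value s κ.< i) → h (x , s , false) ≡ b₀ × h (x , s , true) ≡ b₁)

        encoded : {X : Set} → X <ᶜ ∣ κ ∣ₒ → (f : X → Θ) → ∃[ c ] Encodes f c
        encoded {X} small f = (bound , h) , λ x → lt x
            , (λ s p e → bit-yes (u x) e em p)
            , λ s ¬p → bit-no (u x) false em ¬p , bit-no (u x) true em ¬p
          where
          bound = proj₁ (κ-bounded small (proj₁ ∘ f))
          lt = proj₂ (κ-bounded small (proj₁ ∘ f))
          u = λ x → proj₂ (f x)
          default : Bool → β
          default false = b₀
          default true = b₁
          bit : ∀ {i j} → (κ.Segment i → β) → Bool → Dec (j κ.< i) → β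
          bit u e (yes p) = u (ref _ p)
          bit u e (no _) = default e
          bit-yes : ∀ {i j} (u : κ.Segment i → β) e (d : Dec (j κ.< i)) (p : j κ.< i) → bit u e d ≡ u (ref _ p)
          bit-yes u e (yes _) p = refl
          bit-yes u e (no ¬p) p = ⊥-elim (¬p p)
          bit-no : ∀ {i j} (u : κ.Segment i → β) e (d : Dec (j κ.< i)) → ¬ (j κ.< i) → bit u e d ≡ default e
          bit-no u e (yes p) ¬p = ⊥-elim (¬p p)
          bit-no u e (no _) ¬p = refl
          h : X × (κ.Segment bound × Bool) → β
          h (x , s , e) = bit (u x) e (em {P = value s κ.< proj₁ (f x)})

        encodes-injective : {X : Set} {f g : X → Θ} (c : _) → Encodes f c → Encodes g c → f ≡ g
        encodes-injective {f = f} {g} (b , h) F G = fe λ x → same x (F x) (G x)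
          where
          no-lt : ∀ {i j} (u : κ.Segment j → β) x → i κ.< b → i κ.< j →
            (∀ s → ¬ (value s κ.< i) → h (x , s , false) ≡ b₀ × h (x , s , true) ≡ b₁) →
            (∀ s (lt : value s κ.< j) (e : Bool) → h (x , s , e) ≡ u (ref (value s) lt)) → ⊥
          no-lt {i} u x i<b i<j distinct equal =
            let (e₀ , e₁) = distinct (ref i i<b) κ.<-irrefl in
            b₀≢b₁ (trans (sym e₀) (trans (trans (equal (ref i i<b) i<j false) (sym (equal (ref i i<b) i<j true))) e₁))
          same : ∀ x → _ → _ → f x ≡ g x
          same x (lt , eq , ne) (lt′ , eq′ , ne′) with f x | g x
          ... | (i , u) | (j , v) with κ.compare i j
          ... | tri< i<j _ _ = ⊥-elim (no-lt v x lt i<j ne eq′)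
          ... | tri> _ _ j<i = ⊥-elim (no-lt u x lt′ j<i ne′ eq)
          ... | tri≈ _ refl _ = cong (i ,_) (fe λ s → let s′ = ref (value s) (κ.<-trans (member s) lt) in
                  trans (sym (eq s′ (member s) false)) (eq′ s′ (member s) false))

        -- This is θ^{<κ} = θ. Regularity bounds the lengths of a small family of elements of `Θ` by
        -- one `b`, so the whole family is coded by a single function from a small set to `β`.
        Θ-power : {X : Set} {V : Set a} → X <ᶜ ∣ κ ∣ₒ → V ≲ Θ → (X → V) ≲ Θ
        Θ-power {X = X} {V} small f = →-≲ f
          ⨾ choose-≲ Encodes (encoded small) (λ {f} {g} {c} → encodes-injective c)
          ⨾ Σ-≲ power
          ⨾ ×-≲ κ≲Θ ≲-refl ⨾ Θ-square
          where
          power : ∀ b → (X × (κ.Segment b × Bool) → β) ≲ Θ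
          power b = β-power (×-small small (×-small (segment-small b) Bool-small))
            where
            Bool-small : Bool <ᶜ ∣ κ ∣ₒ
            Bool-small = ≲-<ᶜ-trans (mk↣ {to = λ { false → inj₁ tt ; true → inj₂ tt }}
              (λ { {false} {false} _ → refl ; {true} {true} _ → refl ; {false} {true} () ; {true} {false} () })) (⊎-small ⊤-small ⊤-small)

        Θ-weakPower : IsWeakPower β ∣ κ ∣ₒ Θ
        Θ-weakPower = (λ χ → β-power) , λ μ powers →
          -- Otherwise μ embeds into some `Segment i`, and then so does the set of functions from
          -- `Segment i` to `β`, against Cantor.
          let κ≲μ : ∣ κ ∣ₒ ≲ μ
              κ≲μ = case κ.compare-with μ of λ
                { (inj₁ f) → f
                ; (inj₂ (i , f)) → ⊥-elim (cantor b₀≢b₁ (powers (κ.Segment i) (segment-small i) ⨾ f)) }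
          in Σ-≲ (λ i → powers (κ.Segment i) (segment-small i))
             ⨾ ×-≲ κ≲μ ≲-refl ⨾ infinite-square μ (infinite ⨾ κ≲μ)

-- Isomorphisms and strong embeddings as graphs, and unions of chains

module StrongEmbeddings (em : ∀ {ℓ} → ExcludedMiddle ℓ) (fe : ∀ {a b} → Extensionality a b) where

  open WellOrderTheory em fe
  open CardinalTheory em fe

  private
    variable
      a b c ℓ : Level

  module _ (W : WellOrder c) (w₀ : ∣ W ∣ₒ) where
    open Order W

    All-⋃ : {X : Set a} (P : ∣ W ∣ₒ → X → Set b) → (∀ {i j x} → i < j → P i x → P j x) →
            ∀ {n} {xs : Vec X n} → All (λ x → ∃[ i ] P i x) xs → ∃[ i ] All (P i) xs
    All-⋃ P mono [] = w₀ , []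
    All-⋃ P mono {xs = x ∷ xs} ((i , p) ∷ ps) with All-⋃ P mono ps
    ... | j , qs with compare i j
    ...   | tri< i<j _ _ = j , mono i<j p ∷ qs
    ...   | tri≈ _ refl _ = j , p ∷ qs
    ...   | tri> _ _ j<i = i , p ∷ All.map (mono j<i) qs

    Pointwise-⋃ : {X : Set a} {Y : Set b} (R : ∣ W ∣ₒ → X → Y → Set ℓ) →
                  (∀ {i j x y} → i < j → R i x y → R j x y) →
                  ∀ {n} {xs : Vec X n} {ys : Vec Y n} →
                  Pointwise (λ x y → ∃[ i ] R i x y) xs ys → ∃[ i ] Pointwise (R i) xs ys
    Pointwise-⋃ R mono [] = w₀ , []
    Pointwise-⋃ R mono {xs = _ ∷ _} {_ ∷ _} ((i , p) ∷ ps) with Pointwise-⋃ R mono ps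
    ... | j , qs with compare i j
    ...   | tri< i<j _ _ = j , mono i<j p ∷ qs
    ...   | tri≈ _ refl _ = j , p ∷ qs
    ...   | tri> _ _ j<i = i , p ∷ Pointwise.map (mono j<i) qs

  -- R is the graph of an isomorphism from A ↾ P onto B ↾ Q.
  record IsIso {L : Signature} (A : Structure L) (P : Substructure A)
               (B : Structure L) (Q : Substructure B) (R : ∣ A ∣ → ∣ B ∣ → Set₁) : Set₁ where
    field
      source     : ∀ {x y} → R x y → x ∈ carrier P
      target     : ∀ {x y} → R x y → y ∈ carrier Q
      total      : ∀ {x} → x ∈ carrier P → ∃[ y ] R x y
      onto       : ∀ {y} → y ∈ carrier Q → ∃[ x ] R x y
      functional : ∀ {x y y′} → R x y → R x y′ → y ≡ y′
      injective  : ∀ {x x′ y} → R x y → R x′ y → x ≡ x′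
      fun        : ∀ f {xs ys} → Pointwise R xs ys → R (Structure.fun A f xs) (Structure.fun B f ys)
      rln        : ∀ r {xs ys} → Pointwise R xs ys → Structure.rln A r xs ⇔ Structure.rln B r ys

  open IsIso

  module _ {L : Signature} where

    private
      variable
        A B C M N : Structure L

    isIso-resp : {P : Substructure A} {Q : Substructure B} {P′ : Substructure A} {Q′ : Substructure B}
                 {R : ∣ A ∣ → ∣ B ∣ → Set₁} →
                 carrier P ≐ carrier P′ → carrier Q ≐ carrier Q′ → IsIso A P B Q R → IsIso A P′ B Q′ R
    isIso-resp (p , p′) (q , q′) i = record
      { source = p ∘ source i ; target = q ∘ target i ; total = total i ∘ p′ ; onto = onto i ∘ q′
      ; functional = functional i ; injective = injective i ; fun = fun i ; rln = rln i }

    isIso-rel : {P : Substructure A} {Q : Substructure B} {R R′ : ∣ A ∣ → ∣ B ∣ → Set₁} →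
                (∀ {x y} → R x y → R′ x y) → (∀ {x y} → R′ x y → R x y) → IsIso A P B Q R → IsIso A P B Q R′
    isIso-rel f g i = record
      { source = source i ∘ g ; target = target i ∘ g
      ; total = λ p → map₂ f (total i p) ; onto = λ p → map₂ f (onto i p)
      ; functional = λ r r′ → functional i (g r) (g r′) ; injective = λ r r′ → injective i (g r) (g r′)
      ; fun = λ h ps → f (fun i h (Pointwise.map g ps)) ; rln = λ r ps → rln i r (Pointwise.map g ps) }

    isIso-id : {P : Substructure A} → IsIso A P A P (λ x y → x ∈ carrier P × x ≡ y)
    isIso-id {A} {P} = record
      { source = proj₁
      ; target = λ { (p , refl) → p }
      ; total = λ p → _ , p , refl
      ; onto = λ p → _ , p , refl
      ; functional = λ { (_ , refl) (_ , refl) → refl }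
      ; injective = λ { (_ , refl) (_ , refl) → refl }
      ; fun = λ f ps → case split ps of λ { (qs , refl) → Substructure.closed P f _ qs , refl }
      ; rln = λ r ps → case split ps of λ { (qs , refl) → mk⇔ id id }
      }
      where
      split : ∀ {n} {xs ys : Vec ∣ A ∣ n} → Pointwise (λ x y → x ∈ carrier P × x ≡ y) xs ys →
              All (carrier P) xs × xs ≡ ys
      split [] = [] , refl
      split ((p , refl) ∷ ps) = case split ps of λ { (qs , refl) → p ∷ qs , refl }

    isIso-sym : {P : Substructure A} {Q : Substructure B} {R : ∣ A ∣ → ∣ B ∣ → Set₁} →
                IsIso A P B Q R → IsIso B Q A P (λ y x → R x y)
    isIso-sym i = record
      { source = target i ; target = source i ; total = onto i ; onto = total i
      ; functional = injective i ; injective = functional i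
      ; fun = λ f ps → fun i f (Pointwise.sym id ps)
      ; rln = λ r ps → ⇔-sym (rln i r (Pointwise.sym id ps)) }

    gather : {X Y : Set₁} {R : X → Y → Set₁} {P : Subset X} {n : ℕ} {ys : Vec Y n} →
             All (λ y → ∃[ x ] (R x y × P x)) ys → Σ[ xs ∈ Vec X n ] (Pointwise R xs ys × All P xs)
    gather [] = [] , [] , []
    gather {ys = _ ∷ _} ((x , r , p) ∷ ps) = let (xs , rs , qs) = gather ps in x ∷ xs , r ∷ rs , p ∷ qs

    image-of : {P : Substructure A} {Q : Substructure B} {R : ∣ A ∣ → ∣ B ∣ → Set₁} →
               IsIso A P B Q R → Substructure A → Substructure B
    image-of {A} {R = R} i P₀ = record
      { carrier = λ y → ∃[ x ] (R x y × x ∈ carrier P₀)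
      ; closed = λ f ys ps → let (xs , rs , qs) = gather ps in _ , fun i f rs , Substructure.closed P₀ f xs qs }

    infixr 9 _⨟_
    _⨟_ : (∣ A ∣ → ∣ B ∣ → Set₁) → (∣ B ∣ → ∣ C ∣ → Set₁) → ∣ A ∣ → ∣ C ∣ → Set₁
    (R ⨟ S) x z = ∃[ y ] (R x y × S y z)

    isIso-⨟ : {P : Substructure A} {I Q : Substructure B} {O : Substructure C}
              {R : ∣ A ∣ → ∣ B ∣ → Set₁} {S : ∣ B ∣ → ∣ C ∣ → Set₁} →
              IsIso A P B I R → carrier I ⊆ carrier Q → (j : IsIso B Q C O S) →
              IsIso A P C (image-of j I) (_⨟_ {A} {B} {C} R S)
    isIso-⨟ {A} {B} {C} {R = R} {S} i I⊆Q j = record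
      { source = λ (_ , r , _) → source i r
      ; target = λ (y , r , s) → y , s , target i r
      ; total = λ p → let (y , r) = total i p ; (z , s) = total j (I⊆Q (target i r)) in z , y , r , s
      ; onto = λ (y , s , p) → let (x , r) = onto i p in x , y , r , s
      ; functional = λ { (_ , r , s) (_ , r′ , s′) → case functional i r r′ of λ { refl → functional j s s′ } }
      ; injective = λ { (_ , r , s) (_ , r′ , s′) → case injective j s s′ of λ { refl → injective i r r′ } }
      ; fun = λ f ps → let (_ , rs , ss) = split ps in _ , fun i f rs , fun j f ss
      ; rln = λ r ps → let (_ , rs , ss) = split ps in ⇔-trans (rln i r rs) (rln j r ss)
      }
      where
      split : ∀ {n} {xs : Vec ∣ A ∣ n} {zs : Vec ∣ C ∣ n} → Pointwise (_⨟_ {A} {B} {C} R S) xs zs →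
              Σ[ ys ∈ Vec ∣ B ∣ n ] (Pointwise R xs ys × Pointwise S ys zs)
      split [] = [] , [] , []
      split ((y , r , s) ∷ ps) = let (ys , rs , ss) = split ps in y ∷ ys , r ∷ rs , s ∷ ss

    isIso-trans : {P : Substructure A} {Q : Substructure B} {O : Substructure C}
                  {R : ∣ A ∣ → ∣ B ∣ → Set₁} {S : ∣ B ∣ → ∣ C ∣ → Set₁} →
                  IsIso A P B Q R → IsIso B Q C O S → IsIso A P C O (_⨟_ {A} {B} {C} R S)
    isIso-trans i j = isIso-resp (id , id)
      ((λ (_ , s , _) → target j s) , λ p → let (y , s) = onto j p in y , s , source j s)
      (isIso-⨟ i id j)

    isIso-↾ : {P : Substructure A} → IsIso A P (A ↾ P) (full (A ↾ P)) (λ x s → x ≡ value s)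
    isIso-↾ {A} {P} = record
      { source = λ { {y = s} refl → member s }
      ; target = λ _ → Poly.tt
      ; total = λ p → ref _ p , refl
      ; onto = λ _ → _ , refl
      ; functional = λ { refl eq → ref-≡ eq }
      ; injective = λ { refl refl → refl }
      ; fun = λ f ps → cong (Structure.fun A f) (values ps)
      ; rln = λ r ps → mk⇔ (subst (Structure.rln A r) (values ps)) (subst (Structure.rln A r) (sym (values ps)))
      }
      where
      values : ∀ {n} {xs : Vec ∣ A ∣ n} {ss : Vec ∣ A ↾ P ∣ n} →
               Pointwise (λ x s → x ≡ value s) xs ss → xs ≡ Vec.map value ss
      values [] = refl
      values (eq ∷ eqs) = cong₂ _∷_ eq (values eqs)

    isIso⇒≅ : {R : ∣ M ∣ → ∣ N ∣ → Set₁} → IsIso M (full M) N (full N) R →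
              Σ[ φ ∈ M ≅ N ] (∀ x → R x (_≅_.to φ x))
    isIso⇒≅ {M} {N} {R} i = record
      { bijection = mk↔ₛ′ to from (λ y → functional i (R-to (from y)) (from-R y))
                                  (λ x → injective i (from-R (to x)) (R-to x))
      ; preserves-fun = λ f xs → functional i (R-to _) (fun i f (pointwise xs))
      ; preserves-rln = λ r xs → rln i r (pointwise xs)
      } , R-to
      where
      to : ∣ M ∣ → ∣ N ∣
      to x = proj₁ (total i Poly.tt)
      from : ∣ N ∣ → ∣ M ∣
      from y = proj₁ (onto i {y} Poly.tt)
      R-to : ∀ x → R x (to x)
      R-to x = proj₂ (total i Poly.tt)
      from-R : ∀ y → R (from y) y
      from-R y = proj₂ (onto i Poly.tt)
      pointwise : ∀ {n} (xs : Vec ∣ M ∣ n) → Pointwise R xs (Vec.map to xs)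
      pointwise [] = []
      pointwise (x ∷ xs) = R-to x ∷ pointwise xs

    ≅⇒isIso : (φ : M ≅ N) → IsIso M (full M) N (full N) (λ x y → _≅_.to φ x ≡ y)
    ≅⇒isIso {M} {N} φ = record
      { source = λ _ → Poly.tt
      ; target = λ _ → Poly.tt
      ; total = λ _ → _ , refl
      ; onto = λ {y} _ → F.from y , F.strictlyInverseˡ y
      ; functional = λ { refl refl → refl }
      ; injective = λ eq eq′ → Injection.injective (↔⇒≲ φ.bijection) (trans eq (sym eq′))
      ; fun = λ f ps → trans (φ.preserves-fun f _) (cong (Structure.fun N f) (values ps))
      ; rln = λ r ps → subst (λ ys → Structure.rln M r _ ⇔ Structure.rln N r ys) (values ps) (φ.preserves-rln r _)
      }
      where
      module φ = _≅_ φ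
      module F = Inverse φ.bijection
      values : ∀ {n} {xs : Vec ∣ M ∣ n} {ys : Vec ∣ N ∣ n} →
               Pointwise (λ x y → φ.to x ≡ y) xs ys → Vec.map φ.to xs ≡ ys
      values [] = refl
      values (eq ∷ eqs) = cong₂ _∷_ eq (values eqs)

    isIso⇒↾≅ : {P : Substructure A} {Q : Substructure B} {R : ∣ A ∣ → ∣ B ∣ → Set₁} → IsIso A P B Q R →
               Σ[ φ ∈ A ↾ P ≅ B ↾ Q ] (∀ s → R (value s) (value (_≅_.to φ s)))
    isIso⇒↾≅ {R = R} i =
      let (φ , h) = isIso⇒≅ (isIso-trans (isIso-sym isIso-↾) (isIso-trans i isIso-↾))
      in φ , λ s → case h s of λ { (_ , refl , _ , r , refl) → r }

  module AECTheory {L : Signature} (𝐊 : AEC L) where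
    open AEC 𝐊

    private
      variable
        A B C M N : Structure L

    K-transport : {P : Substructure A} {Q : Substructure B} {R : ∣ A ∣ → ∣ B ∣ → Set₁} →
                  IsIso A P B Q R → K (A ↾ P) → K (B ↾ Q)
    K-transport i = K-iso (proj₁ (isIso⇒↾≅ i))

    K-full : K M → K (M ↾ full M)
    K-full = K-iso (proj₁ (isIso⇒≅ isIso-↾))

    ≺-transport : {P Q : Substructure A} {P′ Q′ : Substructure B} {R : ∣ A ∣ → ∣ B ∣ → Set₁} →
                  IsIso A Q B Q′ R → carrier P ⊆ carrier Q → carrier P′ ⊆ carrier Q′ →
                  (∀ {x y} → R x y → x ∈ carrier P ⇔ y ∈ carrier P′) → A ∣ P ≺ Q → B ∣ P′ ≺ Q′
    ≺-transport i P⊆Q P′⊆Q′ eqv = let (φ , h) = isIso⇒↾≅ i in ≺-iso φ P⊆Q P′⊆Q′ (λ s → eqv (h s))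

    ≺-respˡ : {P P′ Q : Substructure A} → carrier P ≐ carrier P′ → A ∣ P ≺ Q → A ∣ P′ ≺ Q
    ≺-respˡ {A} {P} {P′} {Q} (f , g) P≺Q = ≺-transport (isIso-id {A = A} {P = Q}) (≺⇒⊆ P≺Q) (≺⇒⊆ P≺Q ∘ g)
      (λ { (_ , refl) → mk⇔ f g }) P≺Q

    -- R is the graph of an embedding of A ↾ P into B ↾ N whose image is ≺ B ↾ N.
    IsStrong : (A : Structure L) (P : Substructure A) (B : Structure L) (N : Substructure B) →
               (∣ A ∣ → ∣ B ∣ → Set₁) → Set₂
    IsStrong A P B N R = Σ[ I ∈ Substructure B ] (IsIso A P B I R × B ∣ I ≺ N)

    isStrong-trans : {P : Substructure A} {Q : Substructure B} {O : Substructure C}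
                     {R : ∣ A ∣ → ∣ B ∣ → Set₁} {S : ∣ B ∣ → ∣ C ∣ → Set₁} →
                     IsStrong A P B Q R → IsStrong B Q C O S → IsStrong A P C O (_⨟_ {A = A} {B} {C} R S)
    isStrong-trans (I , i , I≺Q) (J , j , J≺O) =
      image-of j I , isIso-⨟ i (≺⇒⊆ I≺Q) j ,
      ≺-trans (≺-transport j (≺⇒⊆ I≺Q) (λ (_ , s , _) → target j s)
        (λ {x} s → mk⇔ (λ p → x , s , p) λ (x′ , s′ , p) → subst (_∈ carrier I) (injective j s′ s) p) I≺Q) J≺O

    isIso⇒isStrong : {P : Substructure A} {Q : Substructure B} {R : ∣ A ∣ → ∣ B ∣ → Set₁} →
                     K (B ↾ Q) → IsIso A P B Q R → IsStrong A P B Q R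
    isIso⇒isStrong KQ i = _ , i , ≺-refl KQ

    ≺⇒isStrong : {P Q : Substructure A} → A ∣ P ≺ Q → IsStrong A P A Q (λ x y → x ∈ carrier P × x ≡ y)
    ≺⇒isStrong P≺Q = _ , isIso-id , P≺Q

    graph : KEmbedding 𝐊 M N → ∣ M ∣ → ∣ N ∣ → Set₁
    graph e x y = KEmbedding.apply e x ≡ y

    embedding⇒isStrong : (e : KEmbedding 𝐊 M N) → IsStrong M (full M) N (full N) (graph e)
    embedding⇒isStrong {M} {N} e = E.image ,
      isIso-rel (λ { (_ , refl , refl) → refl }) (λ { refl → _ , refl , refl })
        (isIso-trans (≅⇒isIso E.iso) (isIso-sym (isIso-↾ {P = E.image}))) ,
      E.strong
      where module E = KEmbedding e

    isStrong⇒embedding : {Q : Substructure B} {R : ∣ M ∣ → ∣ B ∣ → Set₁} → IsStrong M (full M) B Q R →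
                         Σ[ e ∈ KEmbedding 𝐊 M (B ↾ Q) ] (∀ x → R x (value (KEmbedding.apply e x)))
    isStrong⇒embedding {M = M} s@(I , i , I≺Q) =
      let (J , j , J≺) = isStrong-trans s (isIso⇒isStrong (K-full (proj₂ (≺⇒K I≺Q))) isIso-↾)
          (φ , h) = isIso⇒≅ (isIso-trans j isIso-↾)
      in record { image = J ; strong = J≺ ; iso = φ } ,
         λ x → case h x of λ { (_ , (_ , r , refl) , refl) → r }

    isStrong⇒↾embedding : {P : Substructure A} {Q : Substructure B} {R : ∣ A ∣ → ∣ B ∣ → Set₁} →
                          IsStrong A P B Q R →
                          Σ[ e ∈ KEmbedding 𝐊 (A ↾ P) (B ↾ Q) ] (∀ s → R (value s) (value (KEmbedding.apply e s)))
    isStrong⇒↾embedding s@(I , i , I≺Q) =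
      let (e , h) = isStrong⇒embedding (isStrong-trans
                      (isIso⇒isStrong (K-transport (isIso-sym i) (proj₁ (≺⇒K I≺Q))) (isIso-sym isIso-↾)) s)
      in e , λ x → case h x of λ { (_ , refl , r) → r }

    directed-union : {A : Structure L} (W : WellOrder 0ℓ) → WellOrder.HasLimitLength W →
      (P : ∣ W ∣ₒ → Substructure A) → (let open WellOrder W using (_<_)) →
      (∀ {i j} → i < j → carrier (P i) ⊆ carrier (P j)) → Substructure A
    directed-union {A} W (w₀ , _) P mono = record
      { carrier = ⋃ (λ i → carrier (P i))
      ; closed = λ f xs ps → let (i , qs) = All-⋃ W w₀ (λ i → carrier (P i)) (λ lt p → mono lt p) ps
                             in i , Substructure.closed (P i) f xs qs }

    -- Since all members are strong in the same `N`, coherence turns their inclusions into `≺`, and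
    -- the chain axiom applies.
    continuous-union : {A : Structure L} {N : Substructure A} (W : WellOrder 0ℓ) → WellOrder.HasLimitLength W →
      (let open WellOrder W using (_<_; IsLimit; Segment)) (P : ∣ W ∣ₒ → Substructure A) → (∀ i → A ∣ P i ≺ N) →
      (∀ {i j} → i < j → carrier (P i) ⊆ carrier (P j)) →
      (∀ {j} → IsLimit j → carrier (P j) ⊆ ⋃ {I = Segment j} (λ i → carrier (P (value i)))) →
      (U : Substructure A) → carrier U ≐ ⋃ (λ i → carrier (P i)) → A ∣ U ≺ N
    continuous-union W lim P P≺N mono cont U U≐ =
      proj₂ (proj₂ (chain-union W lim P (λ i → proj₁ (≺⇒K (P≺N i)))
        (record
          { increasing = λ i<j → coherence (mono i<j) (P≺N _) (P≺N _)
          ; continuous = λ l → cont l , λ (i , p) → mono (member i) p })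
        U U≐)) _ P≺N

    -- The chain is made continuous by replacing the members with limit index by the unions
    -- of the preceding ones.
    limit-union : {A : Structure L} {N : Substructure A} (W : WellOrder 0ℓ) → WellOrder.HasLimitLength W →
      (let open WellOrder W using (_<_)) (P : ∣ W ∣ₒ → Substructure A) → (∀ i → A ∣ P i ≺ N) →
      (∀ {i j} → i < j → carrier (P i) ⊆ carrier (P j)) →
      (U : Substructure A) → carrier U ≐ ⋃ (λ i → carrier (P i)) → A ∣ U ≺ N
    limit-union {A} {N} W lim P P≺N mono U U≐ = continuous-union W lim Q Q≺N Q-mono Q-cont U
      ((λ x∈U → let (i , p) = proj₁ U≐ x∈U ; (k , i<k) = proj₂ lim i in k , mono i<k p , λ _ → i , i<k , p)
      , λ (i , p , _) → proj₂ U≐ (i , p))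
      where
      open Order W
      open WellOrder W using (IsLimit)
      Q : ∣ W ∣ₒ → Substructure A
      Q i = record
        -- One formula covers both cases: at an index that is not a limit the implication holds
        -- vacuously.
        { carrier = λ x → x ∈ carrier (P i) × (IsLimit i → ∃[ j ] (j < i × x ∈ carrier (P j)))
        ; closed = λ f xs ps →
            Substructure.closed (P i) f xs (All.map proj₁ ps) ,
            λ l → let (s , qs) = All-⋃ (below W i) (ref _ (proj₂ (proj₁ l))) (λ s → carrier (P (value s)))
                                   (λ lt p → mono (unresize lt) p)
                                   (All.map (λ (_ , h) → let (j , j<i , p) = h l in ref j j<i , p) ps)
                  in value s , member s , Substructure.closed (P (value s)) f xs qs
        }
      Q-mono : ∀ {i j} → i < j → carrier (Q i) ⊆ carrier (Q j)
      Q-mono i<j (p , _) = mono i<j p , λ _ → _ , i<j , p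
      between : ∀ {j} → IsLimit j → ∀ {x} → x ∈ carrier (Q j) → ∃[ k ] (k < j × x ∈ carrier (Q k))
      between l (_ , h) = let (i , i<j , p) = h l
                              (k , i<k , k<j) = proj₂ l i i<j
                          in k , k<j , mono i<k p , λ _ → i , i<k , p
      Q-cont : ∀ {j} → IsLimit j → carrier (Q j) ⊆ ⋃ {I = Segment j} (λ i → carrier (Q (value i)))
      Q-cont l p = let (k , k<j , q) = between l p in ref k k<j , q
      Q≺N : ∀ i → A ∣ Q i ≺ N
      -- At a limit the earlier members of `Q` form a shorter continuous chain, already known to be
      -- strong in `N`; elsewhere `Q i` has the same points as `P i`.
      Q≺N = WF.All.wfRec wellFounded _ _ step
        where
        step : ∀ i → (∀ {j} → j < i → A ∣ Q j ≺ N) → A ∣ Q i ≺ N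
        step i ih with em {P = IsLimit i}
        ... | no ¬l = ≺-respˡ ((λ p → p , λ l → ⊥-elim (¬l l)) , proj₁) (P≺N i)
        ... | yes l = continuous-union (below W i) below-limit (Q ∘ value) (λ s → ih (member s))
                (λ lt p → Q-mono (unresize lt) p) (λ {s} → below-cont {s}) (Q i)
                ((λ p → let (k , k<i , q) = between l p in ref k k<i , q) , λ (s , p) → Q-mono (member s) p)
          where
          below-limit : WellOrder.HasLimitLength (below W i)
          below-limit = ref _ (proj₂ (proj₁ l)) , λ s →
            let (k , s<k , k<i) = proj₂ l (value s) (member s) in ref k k<i , resize s<k
          below-cont : ∀ {s} → WellOrder.IsLimit (below W i) s →
            carrier (Q (value s)) ⊆ ⋃ {I = WellOrder.Segment (below W i) s} (λ t → carrier (Q (value (value t))))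
          below-cont {s} ((t , t<s) , dense) p =
            let l′ : IsLimit (value s)
                l′ = (value t , unresize t<s) , λ j j<s →
                  let (u , j<u , u<s) = dense (ref j (<-trans j<s (member s))) (resize j<s)
                  in value u , unresize j<u , unresize u<s
                (k , k<s , q) = between l′ p
            in ref (ref k (<-trans k<s (member s))) (resize k<s) , q

    -- If the order has a last index, the member there is already the union; otherwise the length is
    -- a limit.
    increasing-union : {A : Structure L} {N : Substructure A} (W : WellOrder 0ℓ) → ∣ W ∣ₒ →
      (let open WellOrder W using (_<_)) (P : ∣ W ∣ₒ → Substructure A) → (∀ i → A ∣ P i ≺ N) →
      (∀ {i j} → i < j → carrier (P i) ⊆ carrier (P j)) →
      (U : Substructure A) → carrier U ≐ ⋃ (λ i → carrier (P i)) → A ∣ U ≺ N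
    increasing-union {A} W w₀ P P≺N mono U U≐ with em {P = ∀ i → ∃[ k ] (WellOrder._<_ W i k)}
    ... | yes unbounded = limit-union W (w₀ , unbounded) P P≺N mono U U≐
    ... | no ¬unbounded =
      let open Order W
          (m , max) = ¬∀⇒∃¬ ¬unbounded
      in ≺-respˡ ((λ p → proj₂ U≐ (m , p)) ,
                  λ p → let (i , q) = proj₁ U≐ p in
                        case ≮⇒≥ {m} {i} (λ lt → max (i , lt)) of λ { (inj₁ lt) → mono lt q ; (inj₂ eq) → subst (λ k → _ ∈ carrier (P k)) eq q })
          (P≺N m)

-- Model-homogeneity of the monster by back and forth

module Homogeneity (em : ∀ {ℓ} → ExcludedMiddle ℓ) (fe : ∀ {a b} → Extensionality a b) where

  open WellOrderTheory em fe
  open CardinalTheory em fe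
  open StrongEmbeddings em fe
  open IsIso

  module MonsterTheory {L : Signature} (𝐊 : AEC L) (amalgamation : Amalgamation 𝐊) (ℭ : Monster 𝐊) where
    open AEC 𝐊 using (K; LS; LS-is; K-set; ≺⇒⊆; ≺⇒K; ≺-refl; ≺-trans; coherence) renaming (_∣_≺_ to _⊢_≺_)
    open AECTheory 𝐊
    open Monster ℭ
    open InMonster ℭ
    open Cardinals index index-OR
    open Order index
    open KEmbedding using (apply)

    U : Set₁
    U = ∣ structure ∣

    LS-infinite : ℕ ≲ LS
    LS-infinite = proj₁ (proj₁ LS-is)

    hull : ∀ {A} (N : Substructure A) → K (A ↾ N) → (X : Subset ∣ A ∣) → X ⊆ carrier N →
           Σ[ M ∈ Substructure A ] (A ⊢ M ≺ N × X ⊆ carrier M × (⟦ carrier M ⟧ ≲ (⟦ X ⟧ ⊎ LS)))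
    hull = proj₂ (proj₂ (proj₁ LS-is)) _

    chain-≺ : ∀ {i j} → i ≤ j → chain i ≺ chain j
    chain-≺ (inj₁ i<j) = IsChain.increasing chain-isChain i<j
    chain-≺ (inj₂ refl) = ≺-refl (chain-K _)

    chain-⊆ : ∀ {i j} → i ≤ j → carrier (chain i) ⊆ carrier (chain j)
    chain-⊆ i≤j = ≺⇒⊆ (chain-≺ i≤j)

    model-raise : ∀ {M i j} → M ≺ chain i → i ≤ j → M ≺ chain j
    model-raise M≺ i≤j = ≺-trans M≺ (chain-≺ i≤j)

    successor-of : ∀ i → ∃[ j ] WellOrder.IsSuccessorOf index i j
    successor-of i = let (j , i<j , least) = minimal (i <_) (above i) in j , i<j , least

    -- Such a point enters the chain at the successor of `k`, so distinct `k` have distinct points.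
    -- Hence late members of the chain have size at least `LS`, as needed to keep amalgams small.
    NewPoint : ∣ index ∣ₒ → U → Set₁
    NewPoint k x = x ∉ carrier (chain k) × (∀ l → k < l → x ∈ carrier (chain l))

    new-point : ∀ k → ∃[ x ] NewPoint k x
    new-point k =
      let (k⁺ , k<k⁺ , least) = successor-of k
          (x , x∈ , x∉) = chain-strict k<k⁺
      in x , x∉ , λ l k<l → chain-⊆ (≮⇒≥ (least l k<l)) x∈

    new-point-injective : ∀ {k l x} → NewPoint k x → NewPoint l x → k ≡ l
    new-point-injective {k} {l} (∉k , ∈k) (∉l , ∈l) with compare k l
    ... | tri< k<l _ _ = ⊥-elim (∉l (∈k l k<l))
    ... | tri≈ _ k≡l _ = k≡l
    ... | tri> _ _ l<k = ⊥-elim (∉k (∈l k l<k))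

    segment-≲-chain : ∀ i → Segment i ≲ ‖ chain i ‖
    segment-≲-chain i = choose-≲ (λ s x → NewPoint (value s) (value x)) total-new
        λ p q → ref-≡ (new-point-injective p q)
      where
      total-new : ∀ s → ∃[ x ] NewPoint (value s) (value x)
      total-new s = let (x , p) = new-point (value s) in ref x (proj₂ p i (member s)) , p

    apply-≲ : ∀ {M N} → KEmbedding 𝐊 M N → ∣ M ∣ ≲ ∣ N ∣
    apply-≲ h = let (_ , i , _) = embedding⇒isStrong h in mk↣ {to = apply h} λ eq → injective i eq refl

    range-≲ : ∀ {M N} (h : KEmbedding 𝐊 M N) → ⟦ (λ z → ∃[ s ] apply h s ≡ z) ⟧ ≲ ∣ M ∣
    range-≲ h = choose-≲ {X = ⟦ (λ z → ∃[ s ] apply h s ≡ z) ⟧} (λ z s → apply h s ≡ value z) (λ z → member z)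
                  λ eq eq′ → ref-≡ (trans (sym eq) eq′)

    corestrict : ∀ {M N} {H : Substructure N} (h : KEmbedding 𝐊 M N) → N ⊢ H ≺ full N →
                 (∀ s → apply h s ∈ carrier H) →
                 Σ[ e ∈ KEmbedding 𝐊 M (N ↾ H) ] (∀ s → apply h s ≡ value (apply e s))
    corestrict {H = H} h H≺N h⊆H = let (I , i , I≺N) = embedding⇒isStrong h in
      isStrong⇒embedding (I , i , coherence (λ p → let (s , eq) = onto i p in subst (_∈ carrier H) eq (h⊆H s)) I≺N H≺N)

    -- Universality in the chain concerns only extensions of the same cardinality, hence the field
    -- `same-size`.
    record Amalgam {M₀ M : Structure L} (f₁ f₂ : KEmbedding 𝐊 M₀ M) : Set₂ where
      field
        N          : Structure L
        N-K        : K N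
        same-size  : ∣ N ∣ ↔ ∣ M ∣
        e₁ e₂      : KEmbedding 𝐊 M N
        commutes   : ∀ s → apply e₁ (apply f₁ s) ≡ apply e₂ (apply f₂ s)

    -- A hull of the two images inside the amalgam has the size of `M`, since `LS` is at most that
    -- size.
    small-subamalgam : ∀ {M₀ M N} → K M → LS ≲ ∣ M ∣ → K N → (f₁ f₂ : KEmbedding 𝐊 M₀ M) (g₁ g₂ : KEmbedding 𝐊 M N) →
                       (∀ s → apply g₁ (apply f₁ s) ≡ apply g₂ (apply f₂ s)) → Amalgam f₁ f₂
    small-subamalgam {M = M} {N} KM LS≲M KN f₁ f₂ g₁ g₂ commutes =
      from-hull (hull (full N) (K-full KN) X (λ _ → Poly.tt))
      where
      X : Subset ∣ N ∣
      X z = (∃[ s ] apply g₁ s ≡ z) ⊎ (∃[ s ] apply g₂ s ≡ z)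
      X⊎LS≲ : IsSet ∣ M ∣ → (⟦ X ⟧ ⊎ LS) ≲ ∣ M ∣
      X⊎LS≲ (S , S↔M) =
        infinite-⊎ infinite (∪-≲ _ _ ⨾ infinite-⊎ infinite (range-≲ g₁ ⨾ M≲S) (range-≲ g₂ ⨾ M≲S)) (LS≲M ⨾ M≲S) ⨾ ↔⇒≲ S↔M
        where
        M≲S : ∣ M ∣ ≲ S
        M≲S = ↔⇒≳ S↔M
        infinite : ℕ ≲ S
        infinite = LS-infinite ⨾ LS≲M ⨾ M≲S
      module _ (H : Substructure N) (H≺N : N ⊢ H ≺ full N) (H≲ : ⟦ carrier H ⟧ ≲ (⟦ X ⟧ ⊎ LS)) where
        from-corestrictions : Σ[ e ∈ KEmbedding 𝐊 M (N ↾ H) ] (∀ s → apply g₁ s ≡ value (apply e s)) →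
                              Σ[ e ∈ KEmbedding 𝐊 M (N ↾ H) ] (∀ s → apply g₂ s ≡ value (apply e s)) → Amalgam f₁ f₂
        from-corestrictions (e₁ , eq₁) (e₂ , eq₂) = record
          { N = N ↾ H
          ; N-K = proj₁ (≺⇒K H≺N)
          ; same-size = cantor-bernstein (H≲ ⨾ X⊎LS≲ (K-set KM)) (apply-≲ e₁)
          ; e₁ = e₁
          ; e₂ = e₂
          ; commutes = λ s → ref-≡ (trans (sym (eq₁ _)) (trans (commutes s) (eq₂ _)))
          }
      from-hull : Σ[ H ∈ Substructure N ] (N ⊢ H ≺ full N × X ⊆ carrier H × (⟦ carrier H ⟧ ≲ (⟦ X ⟧ ⊎ LS))) → Amalgam f₁ f₂
      from-hull (H , H≺N , X⊆H , H≲) = from-corestrictions H H≺N H≲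
        (corestrict g₁ H≺N (λ s → X⊆H (inj₁ (s , refl)))) (corestrict g₂ H≺N (λ s → X⊆H (inj₂ (s , refl))))

    amalgam : ∀ {M₀ M} → K M₀ → K M → LS ≲ ∣ M ∣ → (f₁ f₂ : KEmbedding 𝐊 M₀ M) → Amalgam f₁ f₂
    amalgam KM₀ KM LS≲M f₁ f₂ = case amalgamation KM₀ KM KM f₁ f₂ of λ
      { (N , KN , g₁ , g₂ , commutes) → small-subamalgam KM LS≲M KN f₁ f₂ g₁ g₂ commutes }

    restriction-isStrong : ∀ {P Q : Sub} → K (structure ↾ P) → K (structure ↾ Q) → ∀ {M} →
      (e : KEmbedding 𝐊 (structure ↾ P) M) (g : KEmbedding 𝐊 M (structure ↾ Q)) →
      Σ[ S ∈ (U → U → Set₁) ] (IsStrong structure P structure Q S × (∀ s → S (value s) (value (apply g (apply e s)))))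
    restriction-isStrong {P} {Q} KP KQ {M} e g =
      _ , isStrong-trans (isIso⇒isStrong (K-full KP) (isIso-↾ {A = structure} {P = P}))
            (isStrong-trans (embedding⇒isStrong e)
              (isStrong-trans (embedding⇒isStrong g)
                (isIso⇒isStrong KQ (isIso-sym (isIso-↾ {A = structure} {P = Q}))))) ,
      λ s → s , refl , _ , refl , _ , refl , refl

    -- Amalgamate two copies of ℭᵢ along R and embed the result into the next member of the chain.
    extend-to-successor : ∀ {D E R i j} → IsIso structure D structure E R → D ≺ chain i → E ≺ chain i →
      LS ≲ ‖ chain i ‖ → WellOrder.IsSuccessorOf index i j →
      Σ[ S ∈ (U → U → Set₁) ] (IsStrong structure (chain i) structure (chain j) S × (∀ {x y} → R x y → S x y))
    extend-to-successor {D} {E} {R} {i} {j} iso D≺ E≺ LS≲ j-succ =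
      from-amalgam (isStrong⇒↾embedding (≺⇒isStrong D≺)) (isStrong⇒↾embedding (E , iso , E≺))
      where
      module _ (f₁ f₂ : KEmbedding 𝐊 (structure ↾ D) (structure ↾ chain i))
               (f₁-id : ∀ s → value s ≡ value (apply f₁ s)) (f₂-R : ∀ s → R (value s) (value (apply f₂ s)))
               (am : Amalgam f₁ f₂) where
        open Amalgam am
        R⊆ : (g : KEmbedding 𝐊 N (structure ↾ chain j)) → (∀ t → value (apply g (apply e₂ t)) ≡ value t) →
             {S : U → U → Set₁} → (∀ s → S (value s) (value (apply g (apply e₁ s)))) → ∀ {x y} → R x y → S x y
        R⊆ g g-id {S} S-e₁ {x} {y} r = subst (S x) eq (S-e₁ s)
          where
          d : ⟦ carrier D ⟧
          d = ref x (source iso r)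
          s t : ‖ chain i ‖
          s = ref x (≺⇒⊆ D≺ (source iso r))
          t = ref y (≺⇒⊆ E≺ (target iso r))
          f₁d≡s : apply f₁ d ≡ s
          f₁d≡s = ref-≡ (sym (f₁-id d))
          f₂d≡t : apply f₂ d ≡ t
          f₂d≡t = ref-≡ (functional iso (f₂-R d) r)
          eq : value (apply g (apply e₁ s)) ≡ y
          eq = trans (cong (value ∘ apply g) (trans (cong (apply e₁) (sym f₁d≡s)) (trans (commutes d) (cong (apply e₂) f₂d≡t))))
                     (g-id t)
        result : Σ[ S ∈ (U → U → Set₁) ] (IsStrong structure (chain i) structure (chain j) S × (∀ {x y} → R x y → S x y))
        result =
          -- `N` is viewed as an extension of ℭᵢ through `e₂`, the copy that contains the range of
          -- `R`. So `g` undoes `e₂`, and `e₁` followed by `g` agrees with `R` on its domain.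
          let (g , g-id) = proj₂ (chain-universal j-succ) N N-K e₂ same-size
              (S , S-strong , S-e₁) = restriction-isStrong (chain-K i) (chain-K j) e₁ g
          in S , S-strong , R⊆ g g-id S-e₁
      from-amalgam : Σ[ f ∈ KEmbedding 𝐊 (structure ↾ D) (structure ↾ chain i) ] (∀ s → value s ∈ carrier D × value s ≡ value (apply f s)) →
                     Σ[ f ∈ KEmbedding 𝐊 (structure ↾ D) (structure ↾ chain i) ] (∀ s → R (value s) (value (apply f s))) → _
      from-amalgam (f₁ , f₁-id) (f₂ , f₂-R) =
        result f₁ f₂ (proj₂ ∘ f₁-id) f₂-R (amalgam (proj₁ (≺⇒K D≺)) (chain-K i) LS≲ f₁ f₂)

    record IsPartialIso (R : U → U → Set₁) : Set₂ where
      field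
        dom ran   : Sub
        dom-model : IsModel dom
        ran-model : IsModel ran
        isIso     : IsIso structure dom structure ran R

    open IsPartialIso

    Covers : ∣ index ∣ₒ → (U → U → Set₁) → Set₁
    Covers i R = (∀ {x} → x ∈ carrier (chain i) → ∃[ y ] R x y) × (∀ {y} → y ∈ carrier (chain i) → ∃[ x ] R x y)

    Extension : (U → U → Set₁) → ∣ index ∣ₒ → Set₂
    Extension R i = Σ[ S ∈ (U → U → Set₁) ] (IsPartialIso S × (∀ {x y} → R x y → S x y) × Covers i S)

    -- One round of back and forth: the first extension has domain ℭₗ; extending its inverse to ℭⱼ
    -- makes the range ℭⱼ, which contains ℭₗ.
    extension-at : ∀ {D E R} l → LS ≲ Segment l → IsIso structure D structure E R → D ≺ chain l → E ≺ chain l →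
                   Extension R l
    extension-at {R = R} l LS≲ iso D≺ E≺ = forth (successor-of l)
      where
      LS≲chain : ∀ {m} → l ≤ m → LS ≲ ‖ chain m ‖
      LS≲chain l≤m = LS≲ ⨾ seg-≲ l≤m ⨾ segment-≲-chain _
      module _ {j S} (l≤j : l ≤ j) (R⊆S : ∀ {x y} → R x y → S x y) {I : Sub}
               (iso₁ : IsIso structure (chain l) structure I S) where
        finish : ∀ {k} → Σ[ S′ ∈ (U → U → Set₁) ] (IsStrong structure (chain j) structure (chain k) S′ ×
                                                  (∀ {y x} → S x y → S′ y x)) → Extension R l
        finish {k} (S′ , (J , iso₂ , J≺k) , S⊆S′) =
          (λ x y → S′ y x) ,
          record { dom-model = k , J≺k ; ran-model = j , ≺-refl (chain-K j) ; isIso = isIso-sym iso₂ } ,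
          (λ r → S⊆S′ (R⊆S r)) ,
          (λ x∈ → let (y , s) = total iso₁ x∈ in y , S⊆S′ s) ,
          λ y∈ → total iso₂ (chain-⊆ l≤j y∈)
        back : I ≺ chain j → Σ[ k ∈ ∣ index ∣ₒ ] WellOrder.IsSuccessorOf index j k → Extension R l
        back I≺j (k , k-succ) = finish (extend-to-successor (isIso-sym iso₁) I≺j (chain-≺ l≤j) (LS≲chain l≤j) k-succ)
      forth : Σ[ j ∈ ∣ index ∣ₒ ] WellOrder.IsSuccessorOf index l j → Extension R l
      forth (j , j-succ) =
        let (S , (I , iso₁ , I≺j) , R⊆S) = extend-to-successor iso D≺ E≺ (LS≲chain (inj₂ refl)) j-succ
        in back {S = S} (inj₁ (proj₁ j-succ)) R⊆S iso₁ I≺j (successor-of j)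

    bound₃ : ∀ i j k → ∃[ l ] (i ≤ l × j ≤ l × k ≤ l)
    bound₃ i j k = let (m , i≤m , j≤m) = upper i j
                       (l , m≤l , k≤l) = upper m k
                   in l , ≤-trans i≤m m≤l , ≤-trans j≤m m≤l , k≤l

    extend : ∀ {R} → IsPartialIso R → ∀ i → Extension R i
    extend {R} p i = at (upper i (proj₁ (≲-segment LS)))
      where
      shrink : ∀ {l} → i ≤ l → Extension R l → Extension R i
      shrink i≤l (S , q , R⊆S , covers-dom , covers-ran) =
        S , q , R⊆S , (λ x∈ → covers-dom (chain-⊆ i≤l x∈)) , λ y∈ → covers-ran (chain-⊆ i≤l y∈)
      at : ∃[ m ] (i ≤ m × proj₁ (≲-segment LS) ≤ m) → Extension R i
      at (m , i≤m , LS≤m) =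
        let (a , D≺) = dom-model p
            (b , E≺) = ran-model p
            (l , a≤l , b≤l , m≤l) = bound₃ a b m
        in shrink (≤-trans i≤m m≤l)
             (extension-at l (proj₂ (≲-segment LS) ⨾ seg-≲ (≤-trans LS≤m m≤l)) (isIso p)
               (model-raise D≺ a≤l) (model-raise E≺ b≤l))

    isPartialIso-rel : ∀ {R S} → (∀ {x y} → R x y → S x y) → (∀ {x y} → S x y → R x y) → IsPartialIso R → IsPartialIso S
    isPartialIso-rel f g p = record
      { dom-model = dom-model p ; ran-model = ran-model p ; isIso = isIso-rel f g (isIso p) }

    -- The chain axiom concerns orders in `Set`, so a segment of the class `index` is re-indexed by
    -- a set in bijection with it.
    segment-order : ∀ j → Σ[ W ∈ WellOrder 0ℓ ] Σ[ h ∈ (∣ W ∣ₒ → Segment j) ]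
                    ((∀ s → ∃[ w ] h w ≡ s) × (∀ {v w} → WellOrder._<_ W v w → value (h v) < value (h w)))
    segment-order j =
      let (S , S↔) = segment-set j
          module F = Inverse S↔
      in pullback index (↔⇒≲ S↔ ⨾ ref-≲) , F.to , (λ s → F.from s , F.strictlyInverseˡ s) , unresize

    module _ (j k₀ : ∣ index ∣ₒ) (k₀<j : k₀ < j) (R : ∣ index ∣ₒ → U → U → Set₁)
             (partial : ∀ k → k < j → IsPartialIso (R k))
             (mono : ∀ {k l} → l < j → k < l → ∀ {x y} → R k x y → R l x y) where

      private
        ⋃R : U → U → Set₁
        ⋃R x y = ∃[ s ] R (value {P = _< j} s) x y

        some : Segment j
        some = ref k₀ k₀<j

        p : (s : Segment j) → IsPartialIso (R (value s))
        p s = partial (value s) (member s)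

      pointwise-union : ∀ {n} {xs ys : Vec U n} → Pointwise ⋃R xs ys →
                        Σ[ s ∈ Segment j ] Pointwise (R (value s)) xs ys
      pointwise-union = Pointwise-⋃ (below index j) some (λ s → R (value s)) (λ {_} {t} lt → mono (member t) (unresize lt))

      -- Set many models lie in one common member of the monster's chain, and their union is strong
      -- there.
      union-model : (D : Segment j → Sub) → (∀ s → IsModel (D s)) →
                    (∀ {s t} → value s < value t → carrier (D s) ⊆ carrier (D t)) →
                    (V : Sub) → carrier V ≐ ⋃ (λ s → carrier (D s)) → IsModel V
      union-model D D-model D-mono V V≐ =
        let (W , h , h-onto , h-mono) = segment-order j
            (m , m-bound) = bounded (λ w → proj₁ (D-model (h w)))
            (w₀ , _) = h-onto some
        in m , increasing-union W w₀ (D ∘ h) (λ w → model-raise (proj₂ (D-model (h w))) (inj₁ (m-bound w)))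
                 (λ lt → D-mono (h-mono lt)) V
                 ((λ x∈ → let (s , q) = proj₁ V≐ x∈ ; (w , eq) = h-onto s in
                          w , subst (λ s → _ ∈ carrier (D s)) (sym eq) q) ,
                  λ (w , q) → proj₂ V≐ (h w , q))

      union-isPartialIso : IsPartialIso ⋃R
      union-isPartialIso = record
        { dom = D ; ran = E
        ; dom-model = union-model (dom ∘ p) (dom-model ∘ p)
            (λ {s} {t} lt x∈ → source (isIso (p t)) (mono (member t) lt (proj₂ (total (isIso (p s)) x∈)))) D
            ((λ (_ , s , r) → s , source (isIso (p s)) r) , λ (s , x∈) → map₂ (s ,_) (total (isIso (p s)) x∈))
        ; ran-model = union-model (ran ∘ p) (ran-model ∘ p)
            (λ {s} {t} lt x∈ → target (isIso (p t)) (mono (member t) lt (proj₂ (onto (isIso (p s)) x∈)))) E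
            ((λ (_ , s , r) → s , target (isIso (p s)) r) , λ (s , x∈) → map₂ (s ,_) (onto (isIso (p s)) x∈))
        ; isIso = record
          { source = λ r → _ , r
          ; target = λ r → _ , r
          ; total = id
          ; onto = id
          ; functional = λ r r′ → let (s , r₁ , r₂) = common r r′ in functional (isIso (p s)) r₁ r₂
          ; injective = λ r r′ → let (s , r₁ , r₂) = common r r′ in injective (isIso (p s)) r₁ r₂
          ; fun = fun-union
          ; rln = λ q ps → let (s , rs) = pointwise-union ps in rln (isIso (p s)) q rs
          }
        }
        where
        common : ∀ {x y x′ y′} → ⋃R x y → ⋃R x′ y′ → ∃[ s ] (R (value {P = _< j} s) x y × R (value s) x′ y′)
        common r r′ = case pointwise-union (r ∷ r′ ∷ []) of λ { (s , r₁ ∷ r₂ ∷ []) → s , r₁ , r₂ }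
        fun-union : ∀ f {xs ys} → Pointwise ⋃R xs ys → ⋃R (Structure.fun structure f xs) (Structure.fun structure f ys)
        fun-union f ps = let (s , rs) = pointwise-union ps in s , fun (isIso (p s)) f rs
        D E : Sub
        D = record
          { carrier = λ x → ∃[ y ] ⋃R x y
          ; closed = λ f xs ps → let (ys , rs) = targets ps in _ , fun-union f rs }
          where
          targets : ∀ {n} {xs : Vec U n} → All (λ x → ∃[ y ] ⋃R x y) xs → Σ[ ys ∈ Vec U n ] Pointwise ⋃R xs ys
          targets [] = [] , []
          targets ((y , r) ∷ rs) = let (ys , ss) = targets rs in y ∷ ys , r ∷ ss
        E = record
          { carrier = λ y → ∃[ x ] ⋃R x y
          ; closed = λ f ys ps → let (xs , rs) = sources ps in _ , fun-union f rs }
          where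
          sources : ∀ {n} {ys : Vec U n} → All (λ y → ∃[ x ] ⋃R x y) ys → Σ[ xs ∈ Vec U n ] Pointwise ⋃R xs ys
          sources [] = [] , []
          sources ((x , r) ∷ rs) = let (xs , ss) = sources rs in x ∷ xs , r ∷ ss

    -- Back and forth along the whole chain: stage j extends R₀ and all earlier stages.
    module _ (R₀ : U → U → Set₁) (partial₀ : IsPartialIso R₀) where

      private
        -- The recursion is defined before its stages are known to be partial isomorphisms. Without
        -- an extension the relation is kept as it is, a case that `extend` rules out afterwards.
        choice : ∀ {j R} → Dec (Extension R j) → U → U → Set₁
        choice (yes (S , _)) = S
        choice {R = R} (no _) = R

        -- `R₀` is listed separately because the first stage has no predecessors.
        Union : ∀ j → (Segment j → U → U → Set₁) → U → U → Set₁
        Union j h x y = R₀ x y ⊎ (∃[ s ] h s x y)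

        stages = recursion λ j h → choice {j} {Union j h} em

        G : ∣ index ∣ₒ → U → U → Set₁
        G = proj₁ stages

        Before : ∣ index ∣ₒ → U → U → Set₁
        Before j = Union j (G ∘ value)

        IsStage : ∣ index ∣ₒ → (U → U → Set₁) → Set₂
        IsStage j S = IsPartialIso S × (∀ {x y} → Before j x y → S x y) × Covers j S

        choice-stage : ∀ {j} (d : Dec (Extension (Before j) j)) → IsPartialIso (Before j) → IsStage j (choice d)
        choice-stage (yes (_ , q)) _ = q
        choice-stage (no ¬ext) p = ⊥-elim (¬ext (extend p _))

        earlier : ∀ {j} → (∀ {k} → k < j → IsStage k (G k)) →
                  ∀ {k l} → l < j → k < l → ∀ {x y} → G k x y → G l x y
        earlier ih l<j k<l r = proj₁ (proj₂ (ih l<j)) (inj₂ (ref _ k<l , r))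

        before-partial : ∀ j → (∀ {k} → k < j → IsStage k (G k)) → IsPartialIso (Before j)
        before-partial j ih with em {P = ∃[ k ] k < j}
        ... | no none = isPartialIso-rel inj₁ (λ { (inj₁ r) → r ; (inj₂ (s , _)) → ⊥-elim (none (value s , member s)) }) partial₀
        ... | yes (k₀ , k₀<j) = isPartialIso-rel inj₂
                (λ { (inj₁ r) → ref k₀ k₀<j , proj₁ (proj₂ (ih k₀<j)) (inj₁ r) ; (inj₂ p) → p })
                (union-isPartialIso j k₀ k₀<j G (λ k k<j → proj₁ (ih k<j)) (earlier ih))

        stage : ∀ j → IsStage j (G j)
        stage = WF.All.wfRec wellFounded _ _ λ j ih →
          subst (IsStage j) (sym (proj₂ stages j)) (choice-stage em (before-partial j ih))

        stage-mono : ∀ {k l} → k < l → ∀ {x y} → G k x y → G l x y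
        stage-mono k<l r = proj₁ (proj₂ (stage _)) (inj₂ (ref _ k<l , r))

        index₀ : ∣ index ∣ₒ
        index₀ = proj₁ (dom-model partial₀)

        Limit : U → U → Set₁
        Limit x y = ∃[ j ] G j x y

        pointwise-limit : ∀ {n} {xs ys : Vec U n} → Pointwise Limit xs ys → ∃[ j ] Pointwise (G j) xs ys
        pointwise-limit = Pointwise-⋃ index index₀ G (λ k<l → stage-mono k<l)

        common : ∀ {x y x′ y′} → Limit x y → Limit x′ y′ → ∃[ j ] (G j x y × G j x′ y′)
        common r r′ = case pointwise-limit (r ∷ r′ ∷ []) of λ { (j , r₁ ∷ r₂ ∷ []) → j , r₁ , r₂ }

        stage-iso : ∀ j → IsIso structure _ structure _ (G j)
        stage-iso j = isIso (proj₁ (stage j))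

        limit-isIso : IsIso structure (full structure) structure (full structure) Limit
        limit-isIso = record
          { source = λ _ → Poly.tt
          ; target = λ _ → Poly.tt
          ; total = λ {x} _ → let (j , x∈) = chain-exhausts x ; (y , r) = proj₁ (proj₂ (proj₂ (stage j))) x∈ in y , j , r
          ; onto = λ {y} _ → let (j , y∈) = chain-exhausts y ; (x , r) = proj₂ (proj₂ (proj₂ (stage j))) y∈ in x , j , r
          ; functional = λ r r′ → let (j , r₁ , r₂) = common r r′ in functional (stage-iso j) r₁ r₂
          ; injective = λ r r′ → let (j , r₁ , r₂) = common r r′ in injective (stage-iso j) r₁ r₂
          ; fun = λ f ps → let (j , rs) = pointwise-limit ps in j , fun (stage-iso j) f rs
          ; rln = λ q ps → let (j , rs) = pointwise-limit ps in rln (stage-iso j) q rs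
          }

      -- Stage j covers ℭⱼ on both sides and these models exhaust the monster, so the union of all
      -- stages is an automorphism.
      homogeneity : Σ[ f ∈ structure ≅ structure ] (∀ {x y} → R₀ x y → _≅_.to f x ≡ y)
      homogeneity =
        let (f , h) = isIso⇒≅ limit-isIso
        in f , λ {x} r → functional limit-isIso (h x) (index₀ , proj₁ (proj₂ (stage index₀)) (inj₁ r))

-- Types of small sets, the base of size at most θ, and local character

module Coheirs (em : ∀ {ℓ} → ExcludedMiddle ℓ) (fe : ∀ {a b} → Extensionality a b) where

  open WellOrderTheory em fe
  open CardinalTheory em fe
  open StrongEmbeddings em fe
  open Homogeneity em fe
  open IsIso

  Maybe-≲ : ∀ {a b} {X : Set a} {Y : Set b} → X ≲ Y → Maybe X ≲ (Y ⊎ ⊤)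
  Maybe-≲ {X = X} {Y} f = mk↣ injective′
    where
    h : Maybe X → Y ⊎ ⊤
    h (just x) = inj₁ (Injection.to f x)
    h nothing = inj₂ tt
    injective′ : ∀ {x y} → h x ≡ h y → x ≡ y
    injective′ {just _} {just _} eq = cong just (Injection.injective f (inj₁-injective eq))
    injective′ {nothing} {nothing} _ = refl

  decide : ∀ {ℓ} → Set ℓ → Bool
  decide P = does (em {P = P})

  decide-true : ∀ {ℓ} {P : Set ℓ} → P → decide P ≡ true
  decide-true {P = P} p with em {P = P}
  ... | yes _ = refl
  ... | no ¬p = ⊥-elim (¬p p)

  true-decide : ∀ {ℓ} {P : Set ℓ} → decide P ≡ true → P
  true-decide {P = P} eq with em {P = P}
  ... | yes p = p

  decide-⇒ : ∀ {a b} {P : Set a} {Q : Set b} → decide P ≡ decide Q → P → Q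
  decide-⇒ eq p = true-decide (trans (sym eq) (decide-true p))

  module CoheirTheory {L : Signature} (𝐊 : AEC L) (amalgamation : Amalgamation 𝐊) (ℭ : Monster 𝐊)
    (κ : WellOrder 0ℓ) (κ-regular : IsRegular κ) (LS<κ : AEC.LS 𝐊 <ᶜ ∣ κ ∣ₒ) (α : Set) where

    open Signature L
    open AEC 𝐊 using (K; LS; LS-is; ≺⇒⊆; ≺⇒K; ≺-refl; ≺-trans; coherence)
    open AECTheory 𝐊
    open Monster ℭ using (structure; index; index-OR; chain; chain-K; chain-exhausts)
    open InMonster ℭ
    open MonsterTheory 𝐊 amalgamation ℭ
    open Cardinals index index-OR
    open Regular κ κ-regular
    module κ = Order κ

    ℕ-small : ℕ <ᶜ ∣ κ ∣ₒ
    ℕ-small = ≲-<ᶜ-trans LS-infinite LS<κ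

    -- The summand `Fin 2` supplies the two distinct values used for coding and for Cantor's
    -- theorem.
    open Powers ℕ-small {α ⊎ Fin 2} (inj₂ Fin.zero) (inj₂ (Fin.suc Fin.zero)) (λ ()) public

    -- The atomic formulas with variables in S.
    Atom : Set → Set
    Atom S = (S × S) ⊎ (((Σ[ f ∈ Fun ] Vec S (arityF f)) × S) ⊎ (Σ[ r ∈ Rln ] Vec S (arityR r)))

    Holds : {S : Set} → (S → U) → Atom S → Set₁
    Holds d (inj₁ (s , t)) = d s ≡ d t
    Holds d (inj₂ (inj₁ ((f , ss) , t))) = Structure.fun structure f (Vec.map d ss) ≡ d t
    Holds d (inj₂ (inj₂ (r , ss))) = Lift _ (Structure.rln structure r (Vec.map d ss))

    diagram : {S : Set} → (S → U) → Atom S → Bool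
    diagram d q = decide (Holds d q)

    -- The Löwenheim-Skolem number bounds the number of symbols, so there are fewer than κ of them.
    Atom-small : {S : Set} → S <ᶜ ∣ κ ∣ₒ → Atom S <ᶜ ∣ κ ∣ₒ
    Atom-small {S} small = ⊎-small (×-small small small)
      (⊎-small (×-small (≲-<ᶜ-trans (Σ-Vec-≲ arityF) (×-small Fun-small (List-small small))) small)
               (≲-<ᶜ-trans (Σ-Vec-≲ arityR) (×-small Rln-small (List-small small))))
      where
      symbols : (Fun ⊎ Rln) ≲ LS
      symbols = proj₁ (proj₂ (proj₁ LS-is))
      Fun-small : Fun <ᶜ ∣ κ ∣ₒ
      Fun-small = ≲-<ᶜ-trans (mk↣ inj₁-injective ⨾ symbols) LS<κ
      Rln-small : Rln <ᶜ ∣ κ ∣ₒ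
      Rln-small = ≲-<ᶜ-trans (mk↣ inj₂-injective ⨾ symbols) LS<κ

    Closed : {S : Set} → (S → U) → Set₁
    Closed d = ∀ f ss → ∃[ t ] Structure.fun structure f (Vec.map d ss) ≡ d t

    range : {S : Set} (d : S → U) → Closed d → Sub
    range {S} d d-closed = record
      { carrier = λ x → ∃[ s ] d s ≡ x
      ; closed = λ f xs ps → let (ss , eq) = preimages ps
                                 (t , eq′) = d-closed f ss
                             in t , trans (sym eq′) (cong (Structure.fun structure f) eq) }
      where
      preimages : ∀ {n} {xs : Vec U n} → All (λ x → ∃[ s ] d s ≡ x) xs → Σ[ ss ∈ Vec S n ] Vec.map d ss ≡ xs
      preimages [] = [] , refl
      preimages ((s , eq) ∷ ps) = let (ss , eqs) = preimages ps in s ∷ ss , cong₂ _∷_ eq eqs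

    -- Functional atoms name the value by an index. Closure of the range supplies that index, and
    -- equality of the diagrams transfers the equation to the other enumeration.
    same-diagram : {S : Set} {d e : S → U} (d-closed : Closed d) (e-closed : Closed e) →
                   IsModel (range d d-closed) → IsModel (range e e-closed) → diagram d ≡ diagram e →
                   IsPartialIso (λ x y → ∃[ s ] (d s ≡ x × e s ≡ y))
    same-diagram {S} {d} {e} d-closed e-closed d-model e-model eq = record
      { dom = range d d-closed ; ran = range e e-closed ; dom-model = d-model ; ran-model = e-model
      ; isIso = record
        { source = λ (s , p , _) → s , p
        ; target = λ (s , _ , q) → s , q
        ; total = λ (s , p) → e s , s , p , refl
        ; onto = λ (s , q) → d s , s , refl , q
        ; functional = λ { (s , p , refl) (t , p′ , refl) → d⇒e (inj₁ (s , t)) (trans p (sym p′)) }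
        ; injective = λ { (s , refl , q) (t , refl , q′) → e⇒d (inj₁ (s , t)) (trans q (sym q′)) }
        ; fun = λ f ps → case split ps of λ { (ss , refl , refl) →
            let (t , p) = d-closed f ss in t , sym p , sym (d⇒e (inj₂ (inj₁ ((f , ss) , t))) p) }
        ; rln = λ r ps → case split ps of λ { (ss , refl , refl) →
            mk⇔ (λ h → lower (d⇒e (inj₂ (inj₂ (r , ss))) (lift h))) (λ h → lower (e⇒d (inj₂ (inj₂ (r , ss))) (lift h))) }
        }
      }
      where
      d⇒e : ∀ q → Holds d q → Holds e q
      d⇒e q = decide-⇒ (cong (λ h → h q) eq)
      e⇒d : ∀ q → Holds e q → Holds d q
      e⇒d q = decide-⇒ (cong (λ h → h q) (sym eq))
      split : ∀ {n} {xs ys : Vec U n} → Pointwise (λ x y → ∃[ s ] (d s ≡ x × e s ≡ y)) xs ys →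
              Σ[ ss ∈ Vec S n ] (Vec.map d ss ≡ xs × Vec.map e ss ≡ ys)
      split [] = [] , refl , refl
      split ((s , p , q) ∷ ps) = let (ss , ps′ , qs′) = split ps in s ∷ ss , cong₂ _∷_ p ps′ , cong₂ _∷_ q qs′

    -- The type over P of a small set inside a small model that is enumerated by Segment i:
    -- the atomic diagram of the model, the indices of the set, and the names of the elements of P.
    Code : Subset U → ∣ κ ∣ₒ → Set₁
    Code P i = (Atom (κ.Segment i) → Bool) × ((κ.Segment i → Bool) × (κ.Segment i → Maybe ⟦ P ⟧))

    Codes : Subset U → Set₁
    Codes P = Σ[ i ∈ ∣ κ ∣ₒ ] Code P i

    -- A code consists of functions with fewer than κ arguments and at most θ possible values, so
    -- θ^{<κ} = θ bounds their number.
    Codes-≲ : (P : Subset U) → ⟦ P ⟧ ≲ Θ → Codes P ≲ Θ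
    Codes-≲ P P≲Θ = Σ-≲ (λ i → ×-≲ (Θ-power (Atom-small (segment-small i)) Bool≲Θ)
        (×-≲ (Θ-power (segment-small i) Bool≲Θ) (Θ-power (segment-small i) Maybe≲Θ) ⨾ Θ-square) ⨾ Θ-square)
      ⨾ ×-≲ κ≲Θ ≲-refl ⨾ Θ-square
      where
      Maybe≲Θ : Maybe ⟦ P ⟧ ≲ Θ
      Maybe≲Θ = Maybe-≲ P≲Θ ⨾ absorb-⊤ Θ-infinite Θ-square
      Bool≲Θ : Bool ≲ Θ
      Bool≲Θ = mk↣ {to = λ { false → nothing ; true → just tt }}
          (λ { {false} {false} _ → refl ; {true} {true} _ → refl ; {false} {true} () ; {true} {false} () })
        ⨾ Maybe-≲ (≲-⊤ (Injection.to Θ-infinite 0)) ⨾ absorb-⊤ Θ-infinite Θ-square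

    module Realizations (N : Sub) (P : Subset U) where

      -- Only the marked elements have to lie in `N`; the enumerated model around them may be
      -- anywhere in the monster.
      record Realization (c : Codes P) : Set₁ where
        private
          i = proj₁ c
          δ = proj₁ (proj₂ c)
          a = proj₁ (proj₂ (proj₂ c))
          n = proj₂ (proj₂ (proj₂ c))
        field
          enum        : κ.Segment i → U
          enum-closed : Closed enum
          enum-model  : IsModel (range enum enum-closed)
          enum-diag   : diagram enum ≡ δ
          set-in-N    : ∀ s → a s ≡ true → enum s ∈ carrier N
          names       : ∀ s x → n s ≡ just x → enum s ≡ value x

      open Realization

      marked : (c : Codes P) → κ.Segment (proj₁ c) → Bool
      marked (_ , _ , a , _) = a

      -- One fixed decision per code: each code contributes the points of a single realization,
      -- which keeps `Realized` of size at most θ.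
      chosen : (c : Codes P) → Dec (Realization c)
      chosen c = em

      -- The points of one chosen realization in N of each code.
      Realized : Subset U
      Realized x = Σ[ c ∈ Codes P ] Σ[ s ∈ κ.Segment (proj₁ c) ] Σ[ r ∈ Realization c ]
                     (chosen c ≡ yes r × marked c s ≡ true × enum r s ≡ x)

      Realized⊆N : Realized ⊆ carrier N
      Realized⊆N (c , s , r , _ , m , eq) = subst (_∈ carrier N) eq (set-in-N r s m)

      Realized-≲ : ⟦ P ⟧ ≲ Θ → ⟦ Realized ⟧ ≲ Θ
      Realized-≲ P≲Θ = choose-≲ Named named named-inj ⨾ Σ-≲ (λ _ → ref-≲) ⨾ ×-≲ (Codes-≲ P P≲Θ) κ≲Θ ⨾ Θ-square
        where
        Named : ⟦ Realized ⟧ → (Σ[ c ∈ Codes P ] κ.Segment (proj₁ c)) → Set₁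
        Named x (c , s) = Σ[ r ∈ Realization c ] (chosen c ≡ yes r × enum r s ≡ value x)
        named : ∀ x → ∃[ c ] Named x c
        named x = let (c , s , r , eq , _ , eq′) = member x in (c , s) , r , eq , eq′
        named-inj : ∀ {x y c} → Named x c → Named y c → x ≡ y
        named-inj (r , eq , p) (r′ , eq′ , q) with trans (sym eq) eq′
        ... | refl = ref-≡ (trans (sym p) q)

      chosen-realization : ∀ {c} → Realization c → ∃[ r ] chosen c ≡ yes r
      chosen-realization {c} r = from-dec (chosen c)
        where
        from-dec : (d : Dec (Realization c)) → ∃[ r′ ] d ≡ yes r′
        from-dec (yes r′) = r′ , refl
        from-dec (no ¬r) = ⊥-elim (¬r r)

      module _ (N⁻ : Sub) (N⁻⊆P : carrier N⁻ ⊆ P) (A⁻ : Subset U) (A⁻⊆N : A⁻ ⊆ carrier N) where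

        -- The enumeration `d` shows that its own code is realized, so some realization was chosen
        -- for that code. Equal diagrams and homogeneity give an automorphism between the two
        -- enumerations; the marks send the chosen set to `A⁻`, and the names make it fix `N⁻`.
        realize-enumerated : ∀ i (d : κ.Segment i → U) (d-closed : Closed d) → IsModel (range d d-closed) →
          (∀ {x} → x ∈ carrier N⁻ → ∃[ s ] d s ≡ x) → (∀ {x} → x ∈ A⁻ → ∃[ s ] d s ≡ x) →
          Σ[ B⁻ ∈ Subset U ] (B⁻ ⊆ Realized × B⁻ ≡[ carrier N⁻ ] A⁻)
        realize-enumerated i d d-closed d-model N⁻⊆d A⁻⊆d = realize (chosen-realization {c} this)
          where
          name : ∀ {x} → Dec (x ∈ carrier N⁻) → Maybe ⟦ P ⟧
          name {x} (yes p) = just (ref x (N⁻⊆P p))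
          name (no _) = nothing
          name-sound : ∀ {x} (p? : Dec (x ∈ carrier N⁻)) y → name p? ≡ just y → x ≡ value y
          name-sound (yes p) _ refl = refl
          name-complete : ∀ {x} (p? : Dec (x ∈ carrier N⁻)) (p : x ∈ carrier N⁻) → name p? ≡ just (ref x (N⁻⊆P p))
          name-complete (yes _) p = refl
          name-complete (no ¬p) p = ⊥-elim (¬p p)
          c : Codes P
          c = i , diagram d , (λ s → decide (d s ∈ A⁻)) , λ s → name (em {P = d s ∈ carrier N⁻})
          this : Realization c
          this = record
            { enum = d ; enum-closed = d-closed ; enum-model = d-model ; enum-diag = refl
            ; set-in-N = λ s eq → A⁻⊆N (true-decide eq) ; names = λ s → name-sound em }
          realize : ∃[ r ] chosen c ≡ yes r → Σ[ B⁻ ∈ Subset U ] (B⁻ ⊆ Realized × B⁻ ≡[ carrier N⁻ ] A⁻)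
          realize (r , chosen≡) = B⁻ , (λ (s , m , eq) → c , s , r , chosen≡ , m , eq) , f , fixes , image , image⁻¹
            where
            e = enum r
            B⁻ : Subset U
            B⁻ x = ∃[ s ] (marked c s ≡ true × e s ≡ x)
            auto = homogeneity _ (same-diagram (enum-closed r) d-closed (enum-model r) d-model (enum-diag r))
            f = proj₁ auto
            f-e : ∀ s → _≅_.to f (e s) ≡ d s
            f-e s = proj₂ auto (s , refl , refl)
            fixes : ∀ x → x ∈ carrier N⁻ → _≅_.to f x ≡ x
            fixes x x∈ = let (s , eq) = N⁻⊆d x∈
                             p = subst (_∈ carrier N⁻) (sym eq) x∈
                             -- An element of `N⁻` is named in the code, so both enumerations take
                             -- the same value at its index.
                             es≡ds = names r s (ref (d s) (N⁻⊆P p)) (name-complete em p)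
                         in trans (cong (_≅_.to f) (trans (sym eq) (sym es≡ds))) (trans (f-e s) eq)
            image : ∀ {y} → ∃[ x ] (x ∈ B⁻ × _≅_.to f x ≡ y) → y ∈ A⁻
            image (_ , (s , m , refl) , refl) = subst (_∈ A⁻) (sym (f-e s)) (true-decide m)
            image⁻¹ : ∀ {y} → y ∈ A⁻ → ∃[ x ] (x ∈ B⁻ × _≅_.to f x ≡ y)
            image⁻¹ y∈ = let (s , eq) = A⁻⊆d y∈
                         in e s , (s , decide-true (subst (_∈ A⁻) (sym eq) y∈) , refl) , trans (f-e s) eq

        realize-in : (V : Sub) → IsModel V → {x₀ : U} → x₀ ∈ carrier V →
          (∀ {x} → x ∈ carrier N⁻ → x ∈ carrier V) → (∀ {x} → x ∈ A⁻ → x ∈ carrier V) →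
          ‖ V ‖ <ᶜ ∣ κ ∣ₒ → Σ[ B⁻ ∈ Subset U ] (B⁻ ⊆ Realized × B⁻ ≡[ carrier N⁻ ] A⁻)
        realize-in V V-model {x₀} x₀∈V N⁻⊆V A⁻⊆V V-small = enumerate (small⇒segment V-small)
          where
          enumerate : ∃[ i ] ‖ V ‖ ≲ κ.Segment i → Σ[ B⁻ ∈ Subset U ] (B⁻ ⊆ Realized × B⁻ ≡[ carrier N⁻ ] A⁻)
          enumerate (i , h) = realize-enumerated i d d-closed
              (proj₁ V-model , ≺-respˡ (d-onto , λ { (s , refl) → d∈V s }) (proj₂ V-model))
              (d-onto ∘ N⁻⊆V) (d-onto ∘ A⁻⊆V)
            where
            module h = Injection h
            inverse : ∀ s → ∃[ x ] (∀ y → h.to y ≡ s → y ≡ x)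
            inverse s = from-dec em
              where
              from-dec : Dec (∃[ x ] h.to x ≡ s) → ∃[ x ] (∀ y → h.to y ≡ s → y ≡ x)
              from-dec (yes (x , eq)) = x , λ y eq′ → h.injective (trans eq′ (sym eq))
              -- Indices outside the range of `h` repeat the default `x₀`, so that the whole segment
              -- enumerates `V`.
              from-dec (no ¬p) = ref x₀ x₀∈V , λ y eq → ⊥-elim (¬p (y , eq))
            d : κ.Segment i → U
            d s = value (proj₁ (inverse s))
            d∈V : ∀ s → d s ∈ carrier V
            d∈V s = member (proj₁ (inverse s))
            d-onto : ∀ {x} → x ∈ carrier V → ∃[ s ] d s ≡ x
            d-onto x∈ = h.to (ref _ x∈) , cong value (sym (proj₂ (inverse _) (ref _ x∈) refl))
            d-closed : Closed d
            d-closed f ss = let (s , eq) = d-onto (Substructure.closed V f (Vec.map d ss) (all-in ss)) in s , sym eq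
              where
              all-in : ∀ {n} (ss : Vec (κ.Segment i) n) → All (carrier V) (Vec.map d ss)
              all-in [] = []
              all-in (s ∷ ss) = d∈V s ∷ all-in ss

        -- A hull of `N⁻`, `A⁻` and the default point inside `V` is small because LS < κ, and it
        -- serves as the enumerated model.
        realize : (V : Sub) → IsModel V → {x₀ : U} → x₀ ∈ carrier V → carrier N⁻ ⊆ carrier V → carrier N ⊆ carrier V →
          ‖ N⁻ ‖ <ᶜ ∣ κ ∣ₒ → ⟦ A⁻ ⟧ <ᶜ ∣ κ ∣ₒ → Σ[ B⁻ ∈ Subset U ] (B⁻ ⊆ Realized × B⁻ ≡[ carrier N⁻ ] A⁻)
        realize V (k , V≺) {x₀} x₀∈V N⁻⊆V N⊆V N⁻-small A⁻-small =
          from-hull (hull V (proj₁ (≺⇒K V≺)) X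
            (λ { (inj₁ p) → N⁻⊆V p ; (inj₂ (inj₁ p)) → N⊆V (A⁻⊆N p) ; (inj₂ (inj₂ refl)) → x₀∈V }))
          where
          X : Subset U
          X x = x ∈ carrier N⁻ ⊎ (x ∈ A⁻ ⊎ x ≡ x₀)
          X-small : ⟦ X ⟧ <ᶜ ∣ κ ∣ₒ
          X-small = ≲-<ᶜ-trans (∪-≲ _ _ ⨾ ⊎-≲ ≲-refl (∪-≲ _ _ ⨾ ⊎-≲ ≲-refl singleton))
                      (⊎-small N⁻-small (⊎-small A⁻-small ⊤-small))
            where
            singleton : Refinement U (_≡ x₀) ≲ ⊤
            singleton = mk↣ {to = λ _ → tt} λ {s} {t} _ → ref-≡ (trans (member s) (sym (member t)))
          from-hull : Σ[ M ∈ Sub ] (M ≺ V × X ⊆ carrier M × (‖ M ‖ ≲ (⟦ X ⟧ ⊎ LS))) →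
                      Σ[ B⁻ ∈ Subset U ] (B⁻ ⊆ Realized × B⁻ ≡[ carrier N⁻ ] A⁻)
          from-hull (M , M≺V , X⊆M , M≲) = realize-in M (k , ≺-trans M≺V V≺) (X⊆M (inj₂ (inj₂ refl)))
            (λ p → X⊆M (inj₁ p)) (λ p → X⊆M (inj₂ (inj₁ p))) (≲-<ᶜ-trans M≲ (⊎-small X-small LS<κ))

    -- The interleaved construction of M and M₁

    module Closure (N V : Sub) (N≺V : N ≺ V) (V-model : IsModel V) (κ≲N : ∣ κ ∣ₒ ≲ ‖ N ‖)
                   (A : Subset U) (A⊆V : A ⊆ carrier V) (A≲Θ : ⟦ A ⟧ ≲ Θ) where

      KN = proj₁ (≺⇒K N≺V)
      KV = proj₂ (≺⇒K N≺V)

      -- A copy of κ inside `N`, placed in the base so that its size is at least κ.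
      Seed : Subset U
      Seed x = ∃[ i ] value (Injection.to κ≲N i) ≡ x

      open module R P = Realizations N P using (Realized; Realized⊆N; Realized-≲)

      -- The recursion must make sense for arbitrary `P`, before its stages are known to lie in `V`;
      -- hence the intersections with `N` here and with `V` in `Upper`.
      Lower : Subset U → Subset U
      Lower P x = (x ∈ P × x ∈ carrier N) ⊎ (x ∈ Seed ⊎ x ∈ Realized P)

      lower-hull : ∀ P → Σ[ M ∈ Sub ] (M ≺ N × Lower P ⊆ carrier M × (‖ M ‖ ≲ (⟦ Lower P ⟧ ⊎ LS)))
      lower-hull P = hull N KN (Lower P) λ
        { (inj₁ (_ , p)) → p
        ; (inj₂ (inj₁ (i , eq))) → subst (_∈ carrier N) eq (member (Injection.to κ≲N i))
        ; (inj₂ (inj₂ p)) → Realized⊆N P p }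

      Upper : Subset U → Subset U
      Upper P x = (x ∈ P × x ∈ carrier V) ⊎ (x ∈ carrier (proj₁ (lower-hull P)) ⊎ x ∈ A)

      upper-hull : ∀ P → Σ[ M ∈ Sub ] (M ≺ V × Upper P ⊆ carrier M × (‖ M ‖ ≲ (⟦ Upper P ⟧ ⊎ LS)))
      upper-hull P = hull V KV (Upper P) λ
        { (inj₁ (_ , p)) → p
        ; (inj₂ (inj₁ p)) → ≺⇒⊆ N≺V (≺⇒⊆ (proj₁ (proj₂ (lower-hull P))) p)
        ; (inj₂ (inj₂ p)) → A⊆V p }

      LS≲Θ : LS ≲ Θ
      LS≲Θ = proj₁ LS<κ ⨾ κ≲Θ

      sum-≲ : ∀ {a b} {X : Set a} {Y : Set b} → X ≲ Θ → Y ≲ Θ → (X ⊎ Y) ≲ Θ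
      sum-≲ = infinite-⊎ Θ-infinite

      lower-≲ : ∀ P → ⟦ P ⟧ ≲ Θ → ‖ proj₁ (lower-hull P) ‖ ≲ Θ
      lower-≲ P P≲Θ = proj₂ (proj₂ (proj₂ (lower-hull P))) ⨾ sum-≲
        (∪-≲ _ _ ⨾ sum-≲ (⊆-≲ proj₁ ⨾ P≲Θ) (∪-≲ _ _ ⨾ sum-≲ (Seed≲ ⨾ κ≲Θ) (Realized-≲ P P≲Θ))) LS≲Θ
        where
        Seed≲ : ⟦ Seed ⟧ ≲ ∣ κ ∣ₒ
        Seed≲ = choose-≲ {X = ⟦ Seed ⟧} (λ x i → value (Injection.to κ≲N i) ≡ value x) (λ x → member x)
                  λ eq eq′ → ref-≡ (trans (sym eq) eq′)

      upper-≲ : ∀ P → ⟦ P ⟧ ≲ Θ → ‖ proj₁ (upper-hull P) ‖ ≲ Θ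
      upper-≲ P P≲Θ = proj₂ (proj₂ (proj₂ (upper-hull P))) ⨾ sum-≲
        (∪-≲ _ _ ⨾ sum-≲ (⊆-≲ proj₁ ⨾ P≲Θ) (∪-≲ _ _ ⨾ sum-≲ (lower-≲ P P≲Θ) A≲Θ)) LS≲Θ

      Union : ∀ {i} → (κ.Segment i → Subset U) → Subset U
      Union h x = ∃[ s ] x ∈ h s

      -- Only the carriers of the upper models are remembered; both models of a stage are recovered
      -- as hulls over the union of the earlier carriers.
      stages : Σ[ G ∈ (∣ κ ∣ₒ → Subset U) ] (∀ i → G i ≡ carrier (proj₁ (upper-hull (Union {i} (G ∘ value)))))
      stages = κ.recursion λ i h → carrier (proj₁ (upper-hull (Union {i} h)))

      module Stages (G : ∣ κ ∣ₒ → Subset U)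
                    (G≡ : ∀ i → G i ≡ carrier (proj₁ (upper-hull (Union {i} (G ∘ value))))) where

        Before : ∣ κ ∣ₒ → Subset U
        Before i = Union {i} (G ∘ value)

        low up : ∣ κ ∣ₒ → Sub
        low i = proj₁ (lower-hull (Before i))
        up i = proj₁ (upper-hull (Before i))

        low≺N : ∀ i → low i ≺ N
        low≺N i = proj₁ (proj₂ (lower-hull (Before i)))

        up≺V : ∀ i → up i ≺ V
        up≺V i = proj₁ (proj₂ (upper-hull (Before i)))

        Lower⊆ : ∀ {i} → Lower (Before i) ⊆ carrier (low i)
        Lower⊆ {i} = proj₁ (proj₂ (proj₂ (lower-hull (Before i))))

        Upper⊆ : ∀ {i} → Upper (Before i) ⊆ carrier (up i)
        Upper⊆ {i} = proj₁ (proj₂ (proj₂ (upper-hull (Before i))))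

        up⊆Before : ∀ {i j} → i κ.< j → carrier (up i) ⊆ Before j
        up⊆Before {i} i<j {x} p = ref i i<j , subst (x ∈_) (sym (G≡ i)) p

        low⊆up : ∀ {i} → carrier (low i) ⊆ carrier (up i)
        low⊆up p = Upper⊆ (inj₂ (inj₁ p))

        low-mono : ∀ {i j} → i κ.< j → carrier (low i) ⊆ carrier (low j)
        low-mono i<j p = Lower⊆ (inj₁ (up⊆Before i<j (low⊆up p) , ≺⇒⊆ (low≺N _) p))

        up-mono : ∀ {i j} → i κ.< j → carrier (up i) ⊆ carrier (up j)
        up-mono i<j p = Upper⊆ (inj₁ (up⊆Before i<j p , ≺⇒⊆ (up≺V _) p))

        Before-≲ : ∀ i → ⟦ Before i ⟧ ≲ Θ
        Before-≲ = WF.All.wfRec κ.wellFounded _ _ λ i ih →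
          ⋃-≲ (λ s → G (value s)) (λ s → subst (λ P → ⟦ P ⟧ ≲ Θ) (sym (G≡ (value s))) (upper-≲ _ (ih (member s))))
          ⨾ ×-≲ (ref-≲ ⨾ κ≲Θ) ≲-refl ⨾ Θ-square

        i₀ : ∣ κ ∣ₒ
        i₀ = Injection.to (IsRegular.infinite κ-regular) 0

        κ-limit : WellOrder.HasLimitLength κ
        κ-limit = i₀ , κ-above

        M M₁ : Sub
        M = directed-union κ κ-limit low low-mono
        M₁ = directed-union κ κ-limit up up-mono

        M≺N : M ≺ N
        M≺N = limit-union κ κ-limit low low≺N low-mono M (id , id)

        M₁≺V : M₁ ≺ V
        M₁≺V = limit-union κ κ-limit up up≺V up-mono M₁ (id , id)

        M≺M₁ : M ≺ M₁
        M≺M₁ = coherence (λ (i , p) → i , low⊆up p) (≺-trans M≺N N≺V) M₁≺V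

        M≲Θ : ‖ M ‖ ≲ Θ
        M≲Θ = ⋃-≲ (λ i → carrier (low i)) (λ i → lower-≲ _ (Before-≲ i)) ⨾ ×-≲ κ≲Θ ≲-refl ⨾ Θ-square

        A⊆M₁ : A ⊆ carrier M₁
        A⊆M₁ p = i₀ , Upper⊆ (inj₂ (inj₂ p))

        κ≲M : ∣ κ ∣ₒ ≲ ‖ M ‖
        κ≲M = mk↣ {to = λ i → ref (value (Injection.to κ≲N i)) (i₀ , Lower⊆ (inj₂ (inj₁ (i , refl))))}
          λ eq → Injection.injective κ≲N (ref-≡ (cong value eq))

        captured : (P : Subset U) → ⟦ P ⟧ <ᶜ ∣ κ ∣ₒ → ((x : ⟦ P ⟧) → ∃[ i ] value x ∈ carrier (up i)) →
                   ∃[ b ] (P ⊆ Before b)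
        captured P P-small occurs =
          let (b , bound) = κ-bounded P-small (proj₁ ∘ occurs)
          in b , λ {x} p → up⊆Before (bound (ref x p)) (proj₂ (occurs (ref x p)))

        coheir : Coheir κ (carrier N) M M₁
        coheir A⁻ A⁻⊆N A⁻-small N⁻ N⁻≺M₁ N⁻-small =
          from-stage (captured (carrier N⁻) N⁻-small (λ x → ≺⇒⊆ N⁻≺M₁ (member x)))
          where
          from-realized : ∀ {b} → Σ[ B⁻ ∈ Subset U ] (B⁻ ⊆ Realized (Before b) × B⁻ ≡[ carrier N⁻ ] A⁻) →
                          Σ[ B⁻ ∈ Subset U ] (B⁻ ⊆ carrier M × B⁻ ≡[ carrier N⁻ ] A⁻)
          from-realized {b} (B⁻ , B⁻⊆ , eqv) = B⁻ , (λ p → b , Lower⊆ (inj₂ (inj₂ (B⁻⊆ p)))) , eqv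
          from-stage : ∃[ b ] (carrier N⁻ ⊆ Before b) →
                       Σ[ B⁻ ∈ Subset U ] (B⁻ ⊆ carrier M × B⁻ ≡[ carrier N⁻ ] A⁻)
          from-stage (b , N⁻⊆) = from-realized {b} (Realizations.realize N (Before b) N⁻ N⁻⊆ A⁻ A⁻⊆N
            V V-model x₀∈V (λ p → ≺⇒⊆ M₁≺V (≺⇒⊆ N⁻≺M₁ p)) (≺⇒⊆ N≺V) N⁻-small A⁻-small)
            where
            x₀∈V : value (Injection.to κ≲N i₀) ∈ carrier V
            x₀∈V = ≺⇒⊆ N≺V (member (Injection.to κ≲N i₀))

    open CoheirProperties κ

    SmallBase : Subset U → Sub → Sub → Set₂
    SmallBase A N M = IsModel≥ κ M × M ≺ N × (‖ M ‖ ≲ Θ) × Coheir κ A M N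

    α≲Θ : α ≲ Θ
    α≲Θ = mk↣ {to = λ x _ → inj₁ x} (λ eq → inj₁-injective (cong (λ h → h tt) eq)) ⨾ β-power {X = ⊤} ⊤-small

    small-base : Symmetry → ∀ N → IsModel≥ κ N → (A : Subset U) → ⟦ A ⟧ ↔ α → Σ[ M ∈ Sub ] SmallBase A N M
    small-base symmetry N ((n , N≺) , κ≲N) A A↔α = in-chain (bounded index-of)
      where
      index-of : α → ∣ index ∣ₒ
      index-of x = proj₁ (chain-exhausts (value (Inverse.from A↔α x)))
      in-chain : ∃[ m ] (∀ x → WellOrder._<_ index (index-of x) m) → Σ[ M ∈ Sub ] SmallBase A N M
      in-chain (m , bound) = from-bound (Order.upper index n m)
        where
        in-chain-m : ∀ (x : ⟦ A ⟧) → value x ∈ carrier (chain m)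
        in-chain-m x = subst (λ y → value y ∈ carrier (chain m)) (Inverse.strictlyInverseʳ A↔α x)
          (chain-⊆ (inj₁ (bound (Inverse.to A↔α x))) (proj₂ (chain-exhausts _)))
        from-bound : ∃[ v ] (Order._≤_ index n v × Order._≤_ index m v) → Σ[ M ∈ Sub ] SmallBase A N M
        from-bound (v , n≤v , m≤v) =
            M , ((n , ≺-trans M≺N N≺) , κ≲M) , M≺N , M≲Θ ,
            λ A⁻ A⁻⊆A → M₁↓N A⁻ (λ p → A⊆M₁ (A⁻⊆A p))
          where
          V-model : IsModel (chain v)
          V-model = v , ≺-refl (chain-K v)
          open Closure N (chain v) (model-raise N≺ n≤v) V-model κ≲N A
            (λ p → chain-⊆ m≤v (in-chain-m (ref _ p))) (↔⇒≲ A↔α ⨾ α≲Θ)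
          open Stages (proj₁ stages) (proj₂ stages)
          M₁↓N : Coheir κ (carrier M₁) M N
          -- This is the clause of symmetry for models: `N` takes the place of the set and `M₁` that
          -- of the larger model.
          M₁↓N = proj₂ (symmetry {M} {M₁} ((n , ≺-trans M≺N N≺) , κ≲M)
            ((v , M₁≺V) , κ≲M ⨾ ⊆-≲ (≺⇒⊆ M≺M₁)) M≺M₁) N ((n , N≺) , κ≲N) M≺N coheir

    local-character-at : Symmetry → (ν : WellOrder 0ℓ) → Θ <ᶜ ∣ ν ∣ₒ → LocalCharacterAt α ν
    local-character-at symmetry ν Θ<ν μ μ-regular ν≲μ M Mμ _ Mμ-model M-chain _ Mμ≐ A A↔α =
      from-base (small-base symmetry Mμ Mμ-model A A↔α)
      where
      module μ = Order μ
      from-base : Σ[ B ∈ Sub ] SmallBase A Mμ B → Σ[ i₀ ∈ ∣ μ ∣ₒ ] Coheir κ A (M i₀) Mμ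
      from-base (B , _ , B≺Mμ , B≲Θ , A↓Mμ) = from-bound
          (Cardinals.Regular.κ-bounded index index-OR μ μ-regular
            (<ᶜ-≲-trans (≲-<ᶜ-trans B≲Θ Θ<ν) ν≲μ) (λ x → proj₁ (occurs x)))
        where
        occurs : (x : ‖ B ‖) → ∃[ i ] value x ∈ carrier (M i)
        occurs x = proj₁ Mμ≐ (≺⇒⊆ B≺Mμ (member x))
        from-bound : ∃[ b ] (∀ x → proj₁ (occurs x) μ.< b) → Σ[ i₀ ∈ ∣ μ ∣ₒ ] Coheir κ A (M i₀) Mμ
        -- Coheir is monotone in the base: the conjugates found inside `B` also lie in `M b`.
        from-bound (b , bound) = b , λ A⁻ A⁻⊆A A⁻-small N⁻ N⁻≺ N⁻-small →
          let (B⁻ , B⁻⊆B , eqv) = A↓Mμ A⁻ A⁻⊆A A⁻-small N⁻ N⁻≺ N⁻-small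
          in B⁻ , (λ p → B⊆ (B⁻⊆B p)) , eqv
          where
          B⊆ : carrier B ⊆ carrier (M b)
          B⊆ p = ≺⇒⊆ (IsChain.increasing M-chain (bound (ref _ p))) (proj₂ (occurs (ref _ p)))

    least-base-bound : Symmetry → ∀ θ⁺ → Θ <ᶜ θ⁺ → Σ[ κ̄ ∈ Set ] (Isκ̄ α κ̄ × κ̄ ≲ θ⁺)
    least-base-bound symmetry θ⁺ Θ<θ⁺ =
      let (κ̄ , is-bound , least) = least-cardinal _ (θ⁺ , bound)
      in κ̄ , (is-bound , least) , least θ⁺ bound
      where
      bound : ∀ N → IsModel≥ κ N → ∀ (A : Subset U) → ⟦ A ⟧ ↔ α →
              Σ[ M ∈ Sub ] IsModel≥ κ M × (M ≺ N) × (‖ M ‖ <ᶜ θ⁺) × Coheir κ A M N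
      bound N N-model A A↔α =
        let (M , M-model , M≺N , M≲Θ , A↓N) = small-base symmetry N N-model A A↔α
        in M , M-model , M≺N , ≲-<ᶜ-trans M≲Θ Θ<θ⁺ , A↓N

    least-local-character : Symmetry → Σ[ ν ∈ WellOrder 0ℓ ] Isκ α ν
    least-local-character symmetry =
      let (ν₀ , ν₀-regular , Θ<ν₀) = regular-above Θ Θ-infinite
      in from-least (least-cardinal Good (_ , ν₀ , refl , ν₀-regular , local-character-at symmetry ν₀ Θ<ν₀))
      where
      -- Leastness is taken over plain types, so the well-order that witnesses regularity is carried
      -- along with its underlying type.
      Good : Set → Set₂
      Good X = Σ[ ν ∈ WellOrder 0ℓ ] (∣ ν ∣ₒ ≡ X × IsRegular ν × LocalCharacterAt α ν)
      from-least : Σ[ X ∈ Set ] (Good X × (∀ Y → Good Y → X ≲ Y)) → Σ[ ν ∈ WellOrder 0ℓ ] Isκ α ν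
      from-least (_ , (ν , refl , ν-regular , ν-local) , least) =
        ν , ν-regular , ν-local , λ ν′ ν′-regular ν′-local → least _ (ν′ , refl , ν′-regular , ν′-local)

theorem6p4 : (∀ {ℓ} → ExcludedMiddle ℓ) → (∀ {a b} → Extensionality a b) →
    ∀ {L : Signature} (𝐊 : AEC L) →
    Amalgamation 𝐊 → JointEmbedding 𝐊 → NoMaximalModels 𝐊 →
    ∀ (ℭ : Monster 𝐊) (κ : WellOrder 0ℓ) → IsRegular κ → AEC.LS 𝐊 <ᶜ ∣ κ ∣ₒ →
    let open InMonster.CoheirProperties ℭ κ in
    Symmetry →
    (∀ (α : Set) →
    Σ[ θ ∈ Set ] Σ[ θ⁺ ∈ Set ] Σ[ κ̄ ∈ Set ]
    IsWeakPower (α ⊎ Fin 2) ∣ κ ∣ₒ θ × IsSuccessor θ θ⁺ × Isκ̄ α κ̄ × κ̄ ≲ θ⁺) ×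
    LocalCharacter
theorem6p4 em fe 𝐊 amalgamation _ _ ℭ κ κ-regular LS<κ symmetry =
  (λ α →
    let module C = Coheirs.CoheirTheory em fe 𝐊 amalgamation ℭ κ κ-regular LS<κ α
        (θ⁺ , is-successor) = CardinalTheory.Cardinals.successor em fe (Monster.index ℭ) (Monster.index-OR ℭ) C.Θ
        (κ̄ , is-κ̄ , κ̄≲θ⁺) = C.least-base-bound symmetry θ⁺ (proj₁ is-successor)
    in C.Θ , θ⁺ , κ̄ , C.Θ-weakPower , is-successor , is-κ̄ , κ̄≲θ⁺) ,
  λ α → Coheirs.CoheirTheory.least-local-character em fe 𝐊 amalgamation ℭ κ κ-regular LS<κ α symmetry
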